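{- Let $S\subseteq T\subseteq\mathbb{N}^*$ be trees, where $T$ is finitely branching and each node of $T$ has at least two successors on $T$. Suppose that $S$ is uniformly branching. Then, in the metric space $[T]$, $$\dim_H[S]=\underline{\dim}_B[S]\quad\text{and}\quad \dim_P[S]=\overline{\dim}_B[S].$$
   Context: $\mathbb{N}^*$ is the set of finite tuples of natural numbers. A tree is a nonempty set of tuples closed under initial segments; the subtree $S$ has no leaves (so that $S$ corresponds to the nonempty closed set $[S]$). $T_n$ is the set of strings in $T$ of length $n$, and $[T]$ is the set of infinite paths through $T$, with the ultrametric $d(f,g)=\max\{|T_n|^{ -1}: f(n)\neq g(n)\}$, where $\max\emptyset=0$. $[S]\subseteq[T]$ is the set of infinite paths through $S$. A tree $S$ is uniformly branching if for each $n$, all strings in $S$ of length $n$ have the same number of successors on $S$. For a bounded set $X$ in a metric space, $N_\alpha(X)$ is the least cardinality of a covering of $X$ by sets of diameter at most $\alpha$, and $$\underline{\dim}_B(X)=\liminf_{\alpha\to0^+}\frac{\log N_\alpha(X)}{\log(1/\alpha)},\qquad \overline{\dim}_B(X)=\limsup_{\alpha\to0^+}\frac{\log N_\alpha(X)}{\log(1/\alpha)}.$$ $\dim_H$ is Hausdorff dimension. $\dim_P$ is packing dimension: for $s\ge0$, let $P^s_0(X)=\lim_{\delta\to0^+}\sup\sum_i (2r_i)^s$, the supremum being over countable families of pairwise disjoint balls with centres in $X$ and radii $r_i\le\delta$; let $P^s(X)=\inf\{\sum_j P^s_0(X_j): X\subseteq\bigcup_{j\in\mathbb{N}} X_j\}$;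 then $\dim_P(X)=\inf\{s: P^s(X)=0\}$. Dimensions may take the value $\infty$. -}

module Defs where

open import Algebra.Bundles using (CommutativeRing)
import Algebra.Properties.Semiring.Mult as Mult
open import Axiom.ExcludedMiddle using (ExcludedMiddle)
open import Data.Empty using (⊥-elim)
open import Data.Fin.Base using (Fin)
open import Data.List.Base using (List; length; foldr; applyUpTo; _++_; _∷ʳ_)
import Data.List.Membership.Propositional as List
open import Data.List.Relation.Unary.Unique.Propositional using (Unique)
open import Data.Maybe.Base using (Maybe; maybe)
open import Data.Maybe.Relation.Unary.All using (All)
open import Data.Maybe.Relation.Unary.Any using (Any)
open import Data.Nat.Base using (ℕ)
open import Data.Product.Base using (∃; ∃₂; _×_; _,_; proj₁; proj₂)
open import Data.Sum.Base using (_⊎_; inj₁; inj₂)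
open import Function.Bundles using (_⇔_)
open import Level using (0ℓ; Setω)
open import Relation.Binary.Core using (Rel)
import Relation.Binary.Construct.Add.Supremum.Equality as AddSupEquality
import Relation.Binary.Construct.Add.Supremum.NonStrict as AddSupNonStrict
open import Relation.Binary.PropositionalEquality.Core using (_≡_; _≢_)
open import Relation.Binary.Structures using (IsTotalOrder)
open import Relation.Nullary.Construct.Add.Supremum using (_⁺; ⊤⁺; [_])
open import Relation.Nullary.Decidable.Core using (yes; no; True; toWitness; fromWitness)
open import Relation.Unary using (Pred; _∈_; _⊆_; _⊥_; ⋃)

------------------------------------------------------------------------
-- Classical logic.  Excluded middle for types also yields countable
-- choice, because ∃ is Σ.

Classical : Setω
Classical = ∀ {ℓ} → ExcludedMiddle ℓ

------------------------------------------------------------------------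
-- The real numbers: a Dedekind-complete ordered field, which is unique up
-- to isomorphism.  The exponential function adds no generality: a
-- homomorphism from (ℝ,+) to (ℝ,·) with 1 + x ≤ exp x is the natural
-- exponential, and log is then determined on the positive reals.
-- The values of _⁻¹ at 0 and of log outside the positive reals are
-- unspecified.

record Reals : Set₁ where
  field
    commutativeRing : CommutativeRing 0ℓ 0ℓ

  open CommutativeRing commutativeRing public
    using (_≈_; _≉_; _+_; _*_; -_; 0#; 1#; semiring; setoid)
    renaming (Carrier to ℝ)

  infix  4 _≤_ _<_
  infix  9 _⁻¹

  field
    _≤_          : Rel ℝ 0ℓ
    isTotalOrder : IsTotalOrder _≈_ _≤_
    +-monoˡ-≤    : ∀ {x y} z → x ≤ y → x + z ≤ y + z
    *-nonneg     : ∀ {x y} → 0# ≤ x → 0# ≤ y → 0# ≤ x * y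
    0≉1          : 0# ≉ 1#
    _⁻¹          : ℝ → ℝ
    *-inverseʳ   : ∀ {x} → x ≉ 0# → x * x ⁻¹ ≈ 1#

  _<_ : Rel ℝ 0ℓ
  x < y = x ≤ y × x ≉ y

  UpperBound : Pred ℝ 0ℓ → Pred ℝ 0ℓ
  UpperBound P u = ∀ x → x ∈ P → x ≤ u

  field
    complete : ∀ (P : Pred ℝ 0ℓ) → ∃ P → ∃ (UpperBound P) →
               ∃ λ u → UpperBound P u × (∀ v → UpperBound P v → u ≤ v)
    exp      : ℝ → ℝ
    exp-cong : ∀ {x y} → x ≈ y → exp x ≈ exp y
    exp-+    : ∀ x y → exp (x + y) ≈ exp x * exp y
    1+x≤exp  : ∀ x → 1# + x ≤ exp x
    log      : ℝ → ℝ
    exp-log  : ∀ {x} → 0# < x → exp (log x) ≈ x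

------------------------------------------------------------------------
-- ℝ⁺ adjoins ∞ = ⊤⁺ to ℝ.  The quantities below are in [0,∞] (except that
-- log N α X ÷ log (1/α) need not be for α ≥ 1, which does not affect its
-- upper and lower limits at 0), and suprema and infima are taken there:
-- sup ∅ = 0 and inf ∅ = ∞.

module ExtendedReals (lem : Classical) (R : Reals) where

  open Reals R
  open IsTotalOrder isTotalOrder using ()
    renaming (refl to ≤-refl; trans to ≤-trans)
  open Mult semiring using () renaming (_×_ to _×ℝ_)
  open AddSupEquality _≈_ public using (_≈⁺_)
  open AddSupNonStrict _≤_ public using (_≤⁺_; [_]; _≤⊤⁺; ≤⁺-trans)

  ℝ⁺ : Set
  ℝ⁺ = ℝ ⁺

  fromℕ : ℕ → ℝ
  fromℕ n = n ×ℝ 1#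

  0⁺ : ℝ⁺
  0⁺ = [ 0# ]

  infix 4 _isSup_

  _isSup_ : ∀ {i} {I : Set i} → ℝ⁺ → (I → ℝ⁺) → Set i
  u isSup f = 0⁺ ≤⁺ u × (∀ i → f i ≤⁺ u) ×
              (∀ v → 0⁺ ≤⁺ v → (∀ i → f i ≤⁺ v) → u ≤⁺ v)

  -- The set whose supremum is taken is resized to level 0 by True, since
  -- completeness is only assumed for ℝ → Set.
  sup-exists : ∀ {i} {I : Set i} (f : I → ℝ⁺) → ∃ λ u → u isSup f
  sup-exists f with lem {P = ∃ λ b → 0# ≤ b × (∀ i → f i ≤⁺ [ b ])}
  ... | no unbounded = ⊤⁺ , (_ ≤⊤⁺) , (λ _ → _ ≤⊤⁺) , least
    where
    least : ∀ v → 0⁺ ≤⁺ v → (∀ i → f i ≤⁺ v) → ⊤⁺ ≤⁺ v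
    least ⊤⁺    _     _  = _ ≤⊤⁺
    least [ b ] [ p ] f≤ = ⊥-elim (unbounded (b , p , f≤))
  ... | yes (b , 0≤b , f≤b) = [ u ] , [ u-ub 0# 0∈P ] , upper , least
    where
    P : Pred ℝ 0ℓ
    P x = True (lem {P = (x ≤ 0#) ⊎ (∃ λ i → [ x ] ≤⁺ f i)})

    0∈P : P 0#
    0∈P = fromWitness (inj₁ ≤-refl)

    below : ∀ v → 0⁺ ≤⁺ [ v ] → (∀ i → f i ≤⁺ [ v ]) → UpperBound P v
    below v [ 0≤v ] f≤v x x∈P with toWitness x∈P
    ... | inj₁ x≤0       = ≤-trans x≤0 0≤v
    ... | inj₂ (i , x≤f) with ≤⁺-trans ≤-trans x≤f (f≤v i)
    ...   | [ x≤v ] = x≤v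

    lub  = complete P (0# , 0∈P) (b , below b [ 0≤b ] f≤b)
    u    = proj₁ lub
    u-ub = proj₁ (proj₂ lub)

    upper : ∀ i → f i ≤⁺ [ u ]
    upper i with f i in eq | f≤b i
    ... | [ x ] | [ _ ] = [ u-ub x (fromWitness (inj₂ (i , x≤fi))) ]
      where
      x≤fi : [ x ] ≤⁺ f i
      x≤fi rewrite eq = [ ≤-refl ]

    least : ∀ v → 0⁺ ≤⁺ v → (∀ i → f i ≤⁺ v) → [ u ] ≤⁺ v
    least ⊤⁺    _   _   = _ ≤⊤⁺
    least [ v ] 0≤v f≤v = [ proj₂ (proj₂ lub) v (below v 0≤v f≤v) ]

  sup : ∀ {i} {I : Set i} → (I → ℝ⁺) → ℝ⁺
  sup f = proj₁ (sup-exists f)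

  LowerBound : ∀ {i} {I : Set i} → (I → ℝ⁺) → ℝ⁺ → Set i
  LowerBound f x = ∀ i → x ≤⁺ f i

  inf : ∀ {i} {I : Set i} → (I → ℝ⁺) → ℝ⁺
  inf f = sup {I = ∃ (LowerBound f)} proj₁

  liminf₀ limsup₀ : (ℝ → ℝ⁺) → ℝ⁺
  liminf₀ f = sup {I = ∃ λ δ → 0# < δ} λ (δ , _) →
              inf {I = ∃ λ α → 0# < α × α ≤ δ} λ (α , _) → f α
  limsup₀ f = inf {I = ∃ λ δ → 0# < δ} λ (δ , _) →
              sup {I = ∃ λ α → 0# < α × α ≤ δ} λ (α , _) → f α

  infixl 6 _+⁺_
  infixr 8 _^_

  _+⁺_ : ℝ⁺ → ℝ⁺ → ℝ⁺
  [ x ] +⁺ [ y ] = [ x + y ]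
  _     +⁺ _     = ⊤⁺

  ∑ : (ℕ → ℝ⁺) → ℝ⁺
  ∑ a = sup λ n → foldr _+⁺_ 0⁺ (applyUpTo a n)

  -- For x in [0,∞] and 0 ≤ s, with x ^ 0 = 1.
  _^_ : ℝ⁺ → ℝ → ℝ⁺
  x ^ s with lem {P = s ≈ 0#}
  x     ^ s | yes _ = [ 1# ]
  ⊤⁺    ^ s | no _  = ⊤⁺
  [ x ] ^ s | no _ with lem {P = 0# < x}
  ... | yes _ = [ exp (s * log x) ]
  ... | no _  = 0⁺

  log⁺ : ℝ⁺ → ℝ⁺
  log⁺ [ x ] = [ log x ]
  log⁺ ⊤⁺    = ⊤⁺

  infixl 7 _÷_

  -- Only used with a positive divisor.
  _÷_ : ℝ⁺ → ℝ → ℝ⁺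
  [ x ] ÷ y = [ x * y ⁻¹ ]
  ⊤⁺    ÷ y = ⊤⁺

------------------------------------------------------------------------
-- Dimensions of the subsets of a metric space.

module Dimensions (lem : Classical) (R : Reals)
                  {M : Set} (d : M → M → Reals.ℝ R ⁺) where

  open Reals R
  open ExtendedReals lem R

  diam : Pred M 0ℓ → ℝ⁺
  diam U = sup {I = ∃₂ λ x y → x ∈ U × y ∈ U} λ (x , y , _) → d x y

  -- The least size of a cover by sets of diameter ≤ α; it is ∞ if there
  -- is no finite cover.
  N : ℝ → Pred M 0ℓ → ℝ⁺
  N α X = inf {I = ∃₂ λ k (U : Fin k → Pred M 0ℓ) →
                     (∀ i → diam (U i) ≤⁺ [ α ]) × X ⊆ ⋃ (Fin k) U}
              λ (k , _) → [ fromℕ k ]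

  lower-dim-B upper-dim-B : Pred M 0ℓ → ℝ⁺
  lower-dim-B X = liminf₀ λ α → log⁺ (N α X) ÷ log (α ⁻¹)
  upper-dim-B X = limsup₀ λ α → log⁺ (N α X) ÷ log (α ⁻¹)

  -- A countable family is a map from ℕ to Maybe, so that finite families,
  -- including the empty one, are allowed.

  record Cover (δ : ℝ) (X : Pred M 0ℓ) : Set₁ where
    field
      sets   : ℕ → Maybe (Pred M 0ℓ)
      small  : ∀ i → All (λ U → diam U ≤⁺ [ δ ]) (sets i)
      covers : ∀ x → x ∈ X → ∃ λ i → Any (x ∈_) (sets i)

  Hδ : ℝ → ℝ → Pred M 0ℓ → ℝ⁺
  Hδ δ s X = inf λ (C : Cover δ X) →
    ∑ λ i → maybe (λ U → diam U ^ s) 0⁺ (Cover.sets C i)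

  -- Hδ increases as δ decreases, so its limit at 0 is a supremum.
  H : ℝ → Pred M 0ℓ → ℝ⁺
  H s X = sup {I = ∃ λ δ → 0# < δ} λ (δ , _) → Hδ δ s X

  dim-H : Pred M 0ℓ → ℝ⁺
  dim-H X = inf {I = ∃ λ s → 0# ≤ s × H s X ≈⁺ 0⁺} λ (s , _) → [ s ]

  -- A ball is given by a centre and a radius, which the underlying set
  -- need not determine.
  record Ball (δ : ℝ) (X : Pred M 0ℓ) : Set where
    field
      centre   : M
      radius   : ℝ
      centre∈X : centre ∈ X
      0<radius : 0# < radius
      radius≤δ : radius ≤ δ

    -- The balls are closed.
    points : Pred M 0ℓ
    points y = d centre y ≤⁺ [ radius ]

  open Ball

  record Packing (δ : ℝ) (X : Pred M 0ℓ) : Set where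
    field
      balls    : ℕ → Maybe (Ball δ X)
      disjoint : ∀ i j → i ≢ j →
                 All (λ b → All (λ c → points b ⊥ points c) (balls j)) (balls i)

  P₀δ : ℝ → ℝ → Pred M 0ℓ → ℝ⁺
  P₀δ δ s X = sup λ (B : Packing δ X) →
    ∑ λ i → maybe (λ b → [ radius b + radius b ] ^ s) 0⁺ (Packing.balls B i)

  -- P₀δ decreases as δ decreases, so its limit at 0 is an infimum.
  P₀ : ℝ → Pred M 0ℓ → ℝ⁺
  P₀ s X = inf {I = ∃ λ δ → 0# < δ} λ (δ , _) → P₀δ δ s X

  P : ℝ → Pred M 0ℓ → ℝ⁺
  P s X = inf {I = ∃ λ (Xs : ℕ → Pred M 0ℓ) → X ⊆ ⋃ ℕ Xs} λ (Xs , _) →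
    ∑ λ j → P₀ s (Xs j)

  dim-P : Pred M 0ℓ → ℝ⁺
  dim-P X = inf {I = ∃ λ s → 0# ≤ s × P s X ≈⁺ 0⁺} λ (s , _) → [ s ]

------------------------------------------------------------------------
-- Trees

HasCard : ∀ {a} {A : Set a} → Pred A 0ℓ → ℕ → Set a
HasCard Q n = ∃ λ xs → length xs ≡ n × Unique xs × (∀ x → x ∈ Q ⇔ x List.∈ xs)

record IsTree (S : Pred (List ℕ) 0ℓ) : Set where
  field
    nonempty : ∃ S
    closed   : ∀ σ τ → σ ++ τ ∈ S → σ ∈ S

Successor : Pred (List ℕ) 0ℓ → List ℕ → Pred ℕ 0ℓ
Successor S σ k = σ ∷ʳ k ∈ S

FinitelyBranching : Pred (List ℕ) 0ℓ → Set
FinitelyBranching S = ∀ σ → σ ∈ S → ∃ (HasCard (Successor S σ))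

TwoSuccessors : Pred (List ℕ) 0ℓ → Set
TwoSuccessors S = ∀ σ → σ ∈ S →
  ∃₂ λ j k → j ≢ k × j ∈ Successor S σ × k ∈ Successor S σ

NoLeaves : Pred (List ℕ) 0ℓ → Set
NoLeaves S = ∀ σ → σ ∈ S → ∃ (Successor S σ)

-- Two sets of natural numbers have the same cardinality iff they have the
-- same finite cardinality or both have none.
UniformlyBranching : Pred (List ℕ) 0ℓ → Set
UniformlyBranching S = ∀ σ τ → σ ∈ S → τ ∈ S → length σ ≡ length τ →
  ∀ n → HasCard (Successor S σ) n ⇔ HasCard (Successor S τ) n

OfLength : Pred (List ℕ) 0ℓ → ℕ → Pred (List ℕ) 0ℓ
OfLength S n σ = σ ∈ S × length σ ≡ n

InfinitePath : Pred (List ℕ) 0ℓ → Pred (ℕ → ℕ) 0ℓ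
InfinitePath S f = ∀ n → applyUpTo f n ∈ S

------------------------------------------------------------------------
-- The space of paths through a tree.  It is a metric space up to
-- pointwise equality of paths when the tree is finitely branching and
-- each node has at least two successors.

module PathSpace (lem : Classical) (R : Reals) (T : Pred (List ℕ) 0ℓ) where

  open Reals R
  open ExtendedReals lem R

  Path : Set
  Path = ∃ (InfinitePath T)

  -- 0 for an infinite set.
  ∣_∣ : Pred (List ℕ) 0ℓ → ℕ
  ∣ Q ∣ with lem {P = ∃ (HasCard Q)}
  ... | yes (n , _) = n
  ... | no _        = 0

  -- |T_n| is increasing, so the supremum is attained at the first
  -- difference if there is one, and is 0 otherwise.
  dist : Path → Path → ℝ⁺
  dist (f , _) (g , _) = sup {I = ∃ λ n → f n ≢ g n} λ (n , _) →
    [ fromℕ ∣ OfLength T n ∣ ⁻¹ ]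

  paths : Pred (List ℕ) 0ℓ → Pred Path 0ℓ
  paths S (f , _) = InfinitePath S f

  open Dimensions lem R dist public

{-# OPTIONS --safe #-}

-- A closed ball of radius α in [T] is a cylinder, given by the first n entries for the least n
-- with |T_n|⁻¹ ≤ α; we call n the level of α.  Thus N_α[S] = |S_n|, and log N_α[S] / log (1/α) ≤ u
-- says that |S_n| α^u ≤ 1.  Uniform branching makes all cylinders of level n carry the same
-- mass |S_n|⁻¹, so that a covering of [S] has total mass at least 1 and a packing at most 1.
-- Comparing |S_n|⁻¹ with α^u thus bounds dim_H from below and dim_P from above.
-- Covers by cylinders of a single level give the upper bound for dim_H.  For the lower bound for
-- dim_P, by Baire category one of countably many sets covering [S] is dense in a cylinder, and
-- its balls of radius α at the strings of level n are a packing of about |S_n| balls.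

module Submission where

open import Algebra.Bundles using (CommutativeRing)
import Algebra.Properties.CommutativeSemigroup as CommutativeSemigroupProperties
import Algebra.Properties.Ring as RingProperties
import Algebra.Properties.Semiring.Mult as Mult
open import Data.Empty using (⊥; ⊥-elim)
open import Data.Fin.Base as Fin using (Fin)
import Data.Fin.Properties as Fin
open import Data.List.Base using (List; []; _∷_; _++_; _∷ʳ_; length; lookup; take; map; concatMap; drop; filter; applyUpTo; foldr; concat)
open import Data.List.Membership.Propositional using () renaming (_∈_ to _∈ˡ_)
open import Data.List.Membership.Propositional.Properties using (∈-concatMap⁻; ∈-concat⁺′; ∈-concat⁻′; ∈-lookup; ∈-filter⁺; ∈-filter⁻; ∈-applyUpTo⁺; ∈-applyUpTo⁻)
open import Data.List.Properties using (length-++; length-++-≤ˡ; length-applyUpTo; ++-assoc; ++-identityʳ; ++-cancelˡ; ∷-injectiveˡ; ∷ʳ-++)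
open import Data.List.Relation.Binary.Disjoint.Propositional using (Disjoint)
open import Data.List.Relation.Unary.All as All using ([]; _∷_)
import Data.List.Relation.Unary.All.Properties as All
open import Data.List.Relation.Unary.AllPairs as AllPairs using (AllPairs; []; _∷_)
import Data.List.Relation.Unary.AllPairs.Properties as AllPairs
open import Data.List.Relation.Unary.Any as Any using (here; there)
import Data.List.Relation.Unary.Any.Properties as Any
open import Data.List.Relation.Unary.Unique.Propositional using (Unique)
import Data.List.Relation.Unary.Unique.Propositional.Properties as Unique
open import Data.Maybe.Base using (Maybe; just; nothing; maybe)
open import Data.Maybe.Relation.Unary.All using (All; just; nothing)
open import Data.Maybe.Relation.Unary.Any using (Any; just)
open import Data.Nat.Base as ℕ using (ℕ; zero; suc)
open import Data.Nat.Induction using (<-rec)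
import Data.Nat.Properties as ℕ
open import Data.Product.Base using (∃; ∃₂; _×_; _,_; proj₁; proj₂)
open import Data.Sum.Base using (_⊎_; inj₁; inj₂; [_,_]′)
open import Function.Base using (_∘_; id)
open import Function.Bundles using (_⇔_; mk⇔; Equivalence)
open import Level using (0ℓ)
open import Relation.Binary.Bundles using (TotalOrder)
open import Relation.Binary.Construct.Add.Point.Equality using (∙≈∙; [_])
import Relation.Binary.Construct.Add.Supremum.NonStrict as AddSupNonStrict
import Relation.Binary.Construct.NonStrictToStrict as NonStrictToStrict
open import Relation.Binary.PropositionalEquality.Core as ≡ using (_≡_; _≢_; refl)
import Relation.Binary.Reasoning.PartialOrder as PartialOrderReasoning
open import Relation.Binary.Structures using (IsTotalOrder)
open import Relation.Nullary.Construct.Add.Supremum using (⊤⁺; [_])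
open import Relation.Nullary.Decidable.Core using (Dec; yes; no)
open import Relation.Nullary.Negation.Core using (¬_; contradiction)
open import Relation.Unary using (Pred; _∈_; _⊆_; ⋃) renaming (_⊥_ to _#_)
open import Defs

-- The pairing of the dimensions comes from the scales at which a bound is available. Coverings and
-- packings may mix scales, so comparing masses needs an inequality at every small `α`; a lower
-- bound on the lower limit or an upper bound on the upper limit supplies it. A family built at one
-- scale needs it only at arbitrarily small `α`, which an upper bound on the lower limit or a lower
-- bound on the upper limit supplies. No measure is constructed. The mass of a cylinder is its share
-- of the strings of one level `L` lying below all cylinders in question, so only finitely many can
-- be treated at a time: compactness reduces a covering to finitely many cylinders, and an infinite
-- packing sum is a supremum of finite sums. Inequalities between dimensions are proved by refuting
-- a gap `s < t`. Exponents `u < w` inserted in the gap yield a factor `pow α (w - u)` tending to 0,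
-- which absorbs constants such as `pow (1# + 1#) w` from diameters `2r`, or the level size of the
-- cylinder found by category.

module Combinatorics where

  open import Data.Nat.Base using (_+_; _*_; _≤_; _<_; z≤n; s≤s; s≤s⁻¹; _⊔_)
  open import Data.Nat.Properties
  open ≡ using (sym; trans; cong; cong₂; subst; subst₂)

  -- Initial segments of paths, and counting in lists.

  infixl 8 _↾_

  _↾_ : (ℕ → ℕ) → ℕ → List ℕ
  _↾_ = applyUpTo

  Through : List ℕ → Pred (ℕ → ℕ) 0ℓ
  Through σ f = f ↾ length σ ≡ σ

  private variable
    A B : Set

  lookup-injective : {xs : List A} → Unique xs → ∀ i j → lookup xs i ≡ lookup xs j → i ≡ j
  lookup-injective (_ ∷ _)    Fin.zero    Fin.zero    _  = refl
  lookup-injective (x∉xs ∷ _) Fin.zero    (Fin.suc j) eq = contradiction eq (All.lookup x∉xs (∈-lookup j))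
  lookup-injective (x∉xs ∷ _) (Fin.suc i) Fin.zero    eq = contradiction (sym eq) (All.lookup x∉xs (∈-lookup i))
  lookup-injective (_ ∷ xs!)  (Fin.suc i) (Fin.suc j) eq = cong Fin.suc (lookup-injective xs! i j eq)

  unique-⊆⇒length≤ : {xs ys : List A} → Unique xs → (∀ {x} → x ∈ˡ xs → x ∈ˡ ys) → length xs ≤ length ys
  unique-⊆⇒length≤ {xs = xs} {ys} xs! xs⊆ys = Fin.injective⇒≤ {f = position} injective
   where
   position : Fin (length xs) → Fin (length ys)
   position i = Any.index (xs⊆ys (∈-lookup i))

   lookup-position : ∀ i → lookup xs i ≡ lookup ys (position i)
   lookup-position i = Any.lookup-index (xs⊆ys (∈-lookup i))

   injective : ∀ {i j} → position i ≡ position j → i ≡ j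
   injective {i} {j} eq = lookup-injective xs! i j
     (trans (lookup-position i) (trans (cong (lookup ys) eq) (sym (lookup-position j))))

  HasCard-unique : {Q : Pred A 0ℓ} → ∀ {m n} → HasCard Q m → HasCard Q n → m ≡ n
  HasCard-unique (xs , refl , xs! , xs⇔) (ys , refl , ys! , ys⇔) = ≤-antisym
   (unique-⊆⇒length≤ xs! λ {x} x∈ → Equivalence.to (ys⇔ x) (Equivalence.from (xs⇔ x) x∈))
   (unique-⊆⇒length≤ ys! λ {x} x∈ → Equivalence.to (xs⇔ x) (Equivalence.from (ys⇔ x) x∈))

  -- Pads a finite family to the `Maybe`-valued sequences of `Cover` and `Packing`. Recursion on
  -- `k`, rather than a test `i < k`, lets sums over the family unfold term by term.
  family : ∀ {a} {A : Set a} {k} → (Fin k → A) → ℕ → Maybe A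
  family {k = zero}  F i       = nothing
  family {k = suc k} F zero    = just (F Fin.zero)
  family {k = suc k} F (suc i) = family (F ∘ Fin.suc) i

  uniform-bound : (P : A → ℕ → Set) → (∀ x {m n} → m ≤ n → P x m → P x n) →
                 ∀ xs → (∀ x → x ∈ˡ xs → ∃ (P x)) → ∃ λ K → ∀ x → x ∈ˡ xs → P x K
  uniform-bound P mono []       bound = 0 , λ _ ()
  uniform-bound P mono (x ∷ xs) bound =
   let (m , Pxm) = bound x (here refl)
       (n , Pn)  = uniform-bound P mono xs λ y y∈ → bound y (there y∈)
   in m ⊔ n , λ { y (here refl) → mono y (m≤m⊔n m n) Pxm
               ; y (there y∈)  → mono y (m≤n⊔m m n) (Pn y y∈) }

  length-concatMap-const : ∀ (f : A → List B) c xs → (∀ x → x ∈ˡ xs → length (f x) ≡ c) →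
                          length (concatMap f xs) ≡ length xs * c
  length-concatMap-const f c []       eq = refl
  length-concatMap-const f c (x ∷ xs) eq = trans (length-++ (f x))
   (cong₂ _+_ (eq x (here refl)) (length-concatMap-const f c xs λ y y∈ → eq y (there y∈)))

  length-concatMap-mono : ∀ {C : Set} (f : A → List B) (g : A → List C) xs → (∀ x → x ∈ˡ xs → length (f x) ≤ length (g x)) →
                         length (concatMap f xs) ≤ length (concatMap g xs)
  length-concatMap-mono f g []       le = z≤n
  length-concatMap-mono f g (x ∷ xs) le = begin
   length (concatMap f (x ∷ xs))                ≡⟨ length-++ (f x) ⟩
   length (f x) + length (concatMap f xs)       ≤⟨ +-mono-≤ (le x (here refl)) (length-concatMap-mono f g xs λ y y∈ → le y (there y∈)) ⟩
   length (g x) + length (concatMap g xs)       ≡⟨ length-++ (g x) ⟨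
   length (concatMap g (x ∷ xs))                ∎
   where open ≤-Reasoning

  length≤-concatMap : ∀ (f : A → List B) {x xs} → x ∈ˡ xs → length (f x) ≤ length (concatMap f xs)
  length≤-concatMap f {x} {_ ∷ xs} (here refl) = length-++-≤ˡ (f x)
  length≤-concatMap f {x} {y ∷ xs} (there x∈)  = begin
   length (f x)                            ≤⟨ length≤-concatMap f x∈ ⟩
   length (concatMap f xs)                 ≤⟨ m≤n+m _ (length (f y)) ⟩
   length (f y) + length (concatMap f xs)  ≡⟨ length-++ (f y) ⟨
   length (concatMap f (y ∷ xs))           ∎
   where open ≤-Reasoning

  length²≤-concatMap : ∀ (f : A → List B) {x y xs} → x ≢ y → x ∈ˡ xs → y ∈ˡ xs →
                      length (f x) + length (f y) ≤ length (concatMap f xs)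
  length²≤-concatMap f x≢y (here refl) (here refl) = contradiction refl x≢y
  length²≤-concatMap f {x} {y} {_ ∷ xs} x≢y (here refl) (there y∈) = begin
   length (f x) + length (f y)             ≤⟨ +-monoʳ-≤ (length (f x)) (length≤-concatMap f y∈) ⟩
   length (f x) + length (concatMap f xs)  ≡⟨ length-++ (f x) ⟨
   length (concatMap f (x ∷ xs))           ∎
   where open ≤-Reasoning
  length²≤-concatMap f {x} {y} {_ ∷ xs} x≢y (there x∈) (here refl) = begin
   length (f x) + length (f y)             ≡⟨ +-comm (length (f x)) _ ⟩
   length (f y) + length (f x)             ≤⟨ +-monoʳ-≤ (length (f y)) (length≤-concatMap f x∈) ⟩
   length (f y) + length (concatMap f xs)  ≡⟨ length-++ (f y) ⟨
   length (concatMap f (y ∷ xs))           ∎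
   where open ≤-Reasoning
  length²≤-concatMap f {x} {y} {z ∷ xs} x≢y (there x∈) (there y∈) = begin
   length (f x) + length (f y)             ≤⟨ length²≤-concatMap f x≢y x∈ y∈ ⟩
   length (concatMap f xs)                 ≤⟨ m≤n+m _ (length (f z)) ⟩
   length (f z) + length (concatMap f xs)  ≡⟨ length-++ (f z) ⟨
   length (concatMap f (z ∷ xs))           ∎
   where open ≤-Reasoning

  take-↾ : ∀ f {m n} → m ≤ n → take m (f ↾ n) ≡ f ↾ m
  take-↾ f z≤n       = refl
  take-↾ f (s≤s m≤n) = cong (f 0 ∷_) (take-↾ (f ∘ suc) m≤n)

  ↾-≤ : ∀ {f g m n} → m ≤ n → f ↾ n ≡ g ↾ n → f ↾ m ≡ g ↾ m
  ↾-≤ {f} {g} {m} m≤n eq = trans (sym (take-↾ f m≤n)) (trans (cong (take m) eq) (take-↾ g m≤n))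

  ↾-ext : ∀ {f g} n → (∀ k → k < n → f k ≡ g k) → f ↾ n ≡ g ↾ n
  ↾-ext zero    eq = refl
  ↾-ext (suc n) eq = cong₂ _∷_ (eq 0 (s≤s z≤n)) (↾-ext n λ k k<n → eq (suc k) (s≤s k<n))

  ↾-lookup : ∀ {f g n k} → k < n → f ↾ n ≡ g ↾ n → f k ≡ g k
  ↾-lookup {n = suc n} {zero}  k<n       eq = ∷-injectiveˡ eq
  ↾-lookup {n = suc n} {suc k} (s≤s k<n) eq = ↾-lookup k<n (cong (drop 1) eq)

  ↾-+ : ∀ f m n → f ↾ (m + n) ≡ f ↾ m ++ (f ∘ (m +_)) ↾ n
  ↾-+ f zero    n = refl
  ↾-+ f (suc m) n = cong (f 0 ∷_) (↾-+ (f ∘ suc) m n)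

  ++-injectiveˡ : ∀ {A : Set} (σ σ′ : List A) {τ τ′} → length σ ≡ length σ′ → σ ++ τ ≡ σ′ ++ τ′ → σ ≡ σ′
  ++-injectiveˡ []      []        _  _  = refl
  ++-injectiveˡ (x ∷ σ) (y ∷ σ′) len eq =
    cong₂ _∷_ (∷-injectiveˡ eq) (++-injectiveˡ σ σ′ (suc-injective len) (cong (drop 1) eq))

  through-++ : ∀ σ {τ f} → Through (σ ++ τ) f → Through σ f
  through-++ σ {τ} {f} eq = ++-injectiveˡ (f ↾ length σ) σ (length-applyUpTo f (length σ))
    (trans (sym (↾-+ f (length σ) (length τ))) (trans (cong (f ↾_) (sym (length-++ σ))) eq))

  through-↾ : ∀ f n → Through (f ↾ n) f
  through-↾ f n = cong (f ↾_) (length-applyUpTo f n)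

  nth : List ℕ → ℕ → ℕ
  -- A default outside the string; `limit-path` reads only positions inside.
  nth []      _       = 0
  nth (x ∷ σ) zero    = x
  nth (x ∷ σ) (suc i) = nth σ i

  nth-++ : ∀ σ τ {i} → i < length σ → nth (σ ++ τ) i ≡ nth σ i
  nth-++ (x ∷ σ) τ {zero}  _         = refl
  nth-++ (x ∷ σ) τ {suc i} (s≤s i<σ) = nth-++ σ τ i<σ

  nth-↾ : ∀ σ → Through σ (nth σ)
  nth-↾ []      = refl
  nth-↾ (x ∷ σ) = cong (x ∷_) (nth-↾ σ)

  -- Paths as limits of growing strings.

  module _ (Q : ℕ → Pred (List ℕ) 0ℓ) (step : ∀ j σ → Q j σ → ∃₂ λ k ρ → Q (suc j) (σ ++ k ∷ ρ)) where

    private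
      chain : ∀ {σ} → Q 0 σ → ∀ j → ∃ (Q j)
      chain {σ} q zero    = σ , q
      chain {σ} q (suc j) = let (σ , q) = chain q j ; (k , ρ , q′) = step j σ q in σ ++ k ∷ ρ , q′

      str : ∀ {σ} → Q 0 σ → ℕ → List ℕ
      str q j = proj₁ (chain q j)

      str-prefix : ∀ {σ} (q : Q 0 σ) d j → ∃ λ μ → str q (d + j) ≡ str q j ++ μ
      str-prefix q zero    j = [] , sym (++-identityʳ _)
      str-prefix q (suc d) j =
        let (μ , eq) = str-prefix q d j
            (k , ρ , _) = step (d + j) _ (proj₂ (chain q (d + j)))
        in μ ++ k ∷ ρ , trans (cong (_++ k ∷ ρ) eq) (++-assoc (str q j) μ _)

      j≤length : ∀ {σ} (q : Q 0 σ) j → j ≤ length (str q j)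
      j≤length q zero    = z≤n
      j≤length q (suc j) = begin
        suc j                            ≤⟨ s≤s (j≤length q j) ⟩
        suc (length (str q j))           ≡⟨ +-comm 1 _ ⟩
        length (str q j) + 1             ≤⟨ +-monoʳ-≤ (length (str q j)) (s≤s z≤n) ⟩
        length (str q j) + suc (length ρ)  ≡⟨ length-++ (str q j) ⟨
        length (str q j ++ k ∷ ρ)        ∎
        where
        open ≤-Reasoning
        k = proj₁ (step j (str q j) (proj₂ (chain q j)))
        ρ = proj₁ (proj₂ (step j (str q j) (proj₂ (chain q j))))

      nth-str : ∀ {σ} (q : Q 0 σ) {i j k} → j ≤ k → i < length (str q j) → nth (str q k) i ≡ nth (str q j) i
      nth-str q {i} {j} {k} j≤k i<j =
        let (μ , eq) = str-prefix q (k ℕ.∸ j) j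
        in trans (cong (λ σ → nth σ i) (trans (cong (str q) (sym (m∸n+n≡m j≤k))) eq)) (nth-++ (str q j) μ i<j)

    -- Each step appends at least one entry, so the string of stage `j` has length at least `j` and
    -- entry `i` can be read off at stage `suc i`. The index of `Q` lets a construction record what
    -- has been achieved by stage `j`.
    limit-path : ∀ σ → Q 0 σ → ∃ λ f → Through σ f × ∀ j → ∃ λ n → j ≤ n × Q j (f ↾ n)
    limit-path σ q = f , through-str 0 , λ j → length (str q j) , j≤length q j , subst (Q j) (sym (through-str j)) (proj₂ (chain q j))
      where
      f : ℕ → ℕ
      f i = nth (str q (suc i)) i

      f≡ : ∀ j i → i < length (str q j) → f i ≡ nth (str q j) i
      f≡ j i i<j with ≤-total j (suc i)
      ... | inj₁ j≤i = nth-str q j≤i i<j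
      ... | inj₂ i≤j = sym (nth-str q i≤j (j≤length q (suc i)))

      through-str : ∀ j → Through (str q j) f
      through-str j = trans (↾-ext _ (f≡ j)) (nth-↾ (str q j))

  -- Trees and the sizes of their levels.

  module TreeProperties (lem : Classical) (S : Pred (List ℕ) 0ℓ) (isTree : IsTree S) where

    open IsTree isTree

    []∈ : [] ∈ S
    []∈ = closed [] (proj₁ nonempty) (proj₂ nonempty)

    -- Choosing the list by `lem` makes it depend on `σ` alone and not on a proof of `σ ∈ S`. In a
    -- finitely branching tree the default `[]` is never taken at a node.
    kids : List ℕ → List ℕ
    kids σ with lem {P = ∃ (HasCard (Successor S σ))}
    ... | yes (_ , xs , _) = xs
    ... | no _             = []

    prefix∈ : ∀ {f m n} → m ≤ n → f ↾ n ∈ S → f ↾ m ∈ S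
    prefix∈ {f} {m} {n} m≤n f∈ = closed (f ↾ m) _ (subst S (trans (cong (f ↾_) (sym (m+[n∸m]≡n m≤n))) (↾-+ f m (n ℕ.∸ m))) f∈)

    -- For a node `σ` of a finitely branching tree, its extensions in `S` by `m` entries, each
    -- listed once; `descendants n []` serves as the level `n`. Branching at `σ` first makes the
    -- length a product when the branching is uniform.
    descendants : ℕ → List ℕ → List (List ℕ)
    descendants zero    σ = σ ∷ []
    descendants (suc m) σ = concatMap (λ k → descendants m (σ ∷ʳ k)) (kids σ)

    module FinitelyBranchingTree (finite : FinitelyBranching S) where

      kids-card : ∀ {σ} → σ ∈ S → Unique (kids σ) × (∀ k → k ∈ Successor S σ ⇔ k ∈ˡ kids σ)
      kids-card {σ} σ∈ with lem {P = ∃ (HasCard (Successor S σ))}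
      ... | yes (_ , _ , _ , xs! , xs⇔) = xs! , xs⇔
      ... | no ¬card = contradiction (finite σ σ∈) ¬card

      kids-sound : ∀ {σ k} → σ ∈ S → k ∈ˡ kids σ → σ ∷ʳ k ∈ S
      kids-sound σ∈ = Equivalence.from (proj₂ (kids-card σ∈) _)

      kids-complete : ∀ {σ k} → σ ∷ʳ k ∈ S → k ∈ˡ kids σ
      kids-complete {σ} σk∈ = Equivalence.to (proj₂ (kids-card (closed σ _ σk∈)) _) σk∈

      descendants-sound : ∀ m {σ ρ} → σ ∈ S → ρ ∈ˡ descendants m σ → ρ ∈ S × ∃ λ μ → length μ ≡ m × ρ ≡ σ ++ μ
      descendants-sound zero {σ} σ∈ (here refl) = σ∈ , [] , refl , sym (++-identityʳ σ)
      descendants-sound (suc m) {σ} σ∈ ρ∈E = go (kids σ) (λ k∈ → k∈) (∈-concatMap⁻ (λ k → descendants m (σ ∷ʳ k)) {xs = kids σ} ρ∈E)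
        where
        go : ∀ {ρ} ks → (∀ {k} → k ∈ˡ ks → k ∈ˡ kids σ) → Any.Any (λ k → ρ ∈ˡ descendants m (σ ∷ʳ k)) ks →
             ρ ∈ S × ∃ λ μ → length μ ≡ suc m × ρ ≡ σ ++ μ
        go (k ∷ ks) ks⊆ (here ρ∈)   =
          let (ρ∈S , μ , len , eq) = descendants-sound m (kids-sound σ∈ (ks⊆ (here refl))) ρ∈
          in ρ∈S , k ∷ μ , cong suc len , trans eq (∷ʳ-++ σ k μ)
        go (k ∷ ks) ks⊆ (there any) = go ks (ks⊆ ∘ there) any

      descendants-complete : ∀ σ μ → σ ++ μ ∈ S → σ ++ μ ∈ˡ descendants (length μ) σ
      descendants-complete σ []      σ∈  = here (++-identityʳ σ)
      descendants-complete σ (k ∷ μ) σμ∈ = ∈-concat⁺′ (subst (_∈ˡ descendants (length μ) (σ ∷ʳ k)) (∷ʳ-++ σ k μ) (descendants-complete (σ ∷ʳ k) μ σkμ∈))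
        (Any.map⁺ (Any.map (λ { refl → refl }) (kids-complete (closed (σ ∷ʳ k) μ σkμ∈))))
        where
        σkμ∈ : (σ ∷ʳ k) ++ μ ∈ S
        σkμ∈ = subst S (sym (∷ʳ-++ σ k μ)) σμ∈

      descendants-unique : ∀ m {σ} → σ ∈ S → Unique (descendants m σ)
      descendants-unique zero    σ∈ = [] ∷ []
      descendants-unique (suc m) {σ} σ∈ = Unique.concat⁺
        (All.map⁺ (All.tabulate λ k∈ → descendants-unique m (kids-sound σ∈ k∈)))
        (AllPairs.map⁺ (disjoint (kids σ) id (proj₁ (kids-card σ∈))))
        where
        disjoint : ∀ ks → (∀ {k} → k ∈ˡ ks → k ∈ˡ kids σ) → Unique ks →
                   AllPairs (λ j k → Disjoint (descendants m (σ ∷ʳ j)) (descendants m (σ ∷ʳ k))) ks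
        disjoint []       ks⊆ []          = []
        -- A common string would have both `j` and `k` as its entry right after `σ`.
        disjoint (j ∷ ks) ks⊆ (j∉ ∷ ks!) = All.tabulate (λ {k} k∈ (ρ∈j , ρ∈k) →
          let (_ , μ , _ , eqj) = descendants-sound m (kids-sound σ∈ (ks⊆ (here refl))) ρ∈j
              (_ , ν , _ , eqk) = descendants-sound m (kids-sound σ∈ (ks⊆ (there k∈))) ρ∈k
              eq = trans (sym eqj) eqk
          in All.lookup j∉ k∈ (∷-injectiveˡ (++-cancelˡ σ _ _ (trans (sym (∷ʳ-++ σ j μ)) (trans eq (∷ʳ-++ σ k ν))))))
          ∷ disjoint ks (ks⊆ ∘ there) ks!

      descendants-through : ∀ m {σ ρ f} → σ ∈ S → ρ ∈ˡ descendants m σ → Through ρ f → Through σ f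
      descendants-through m {σ} {f = f} σ∈ ρ∈ through with descendants-sound m σ∈ ρ∈
      ... | _ , μ , _ , refl = through-++ σ through

      descendants-length : ∀ m {σ ρ} → σ ∈ S → ρ ∈ˡ descendants m σ → length ρ ≡ length σ + m
      descendants-length m {σ} σ∈ ρ∈ with descendants-sound m σ∈ ρ∈
      ... | _ , μ , refl , refl = length-++ σ

      ↾∈descendants : ∀ {f} n m → f ↾ (n + m) ∈ S → f ↾ (n + m) ∈ˡ descendants m (f ↾ n)
      ↾∈descendants {f} n m f∈ = subst₂ (λ ρ l → ρ ∈ˡ descendants l (f ↾ n)) (sym (↾-+ f n m)) (length-applyUpTo _ m)
        (descendants-complete (f ↾ n) _ (subst S (↾-+ f n m) f∈))

      level-card : ∀ n → HasCard (OfLength S n) (length (descendants n []))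
      level-card n = descendants n [] , refl , descendants-unique n []∈ , λ ρ → mk⇔
        (λ { (ρ∈ , refl) → descendants-complete [] ρ ρ∈ })
        (λ ρ∈ → proj₁ (descendants-sound n []∈ ρ∈) , descendants-length n []∈ ρ∈)

    module Growth (finite : FinitelyBranching S) (two : TwoSuccessors S) where

      open FinitelyBranchingTree finite

      length-descendants-mono : ∀ m {σ} → σ ∈ S → length (descendants m σ) ≤ length (descendants (suc m) σ)
      length-descendants-mono zero {σ} σ∈ with two σ σ∈
      ... | j , _ , _ , j∈ , _ = length≤-concatMap (λ k → descendants 0 (σ ∷ʳ k)) (kids-complete j∈)
      length-descendants-mono (suc m) {σ} σ∈ = length-concatMap-mono _ _ (kids σ) λ k k∈ → length-descendants-mono m (kids-sound σ∈ k∈)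

      -- Two successors have more than `m` descendants each, and twice `suc m` is at least
      -- `suc (suc m)`. Linear growth suffices to make the distances in `[T]` tend to 0.
      length-descendants> : ∀ m {σ} → σ ∈ S → m < length (descendants m σ)
      length-descendants> zero    σ∈ = s≤s z≤n
      length-descendants> (suc m) {σ} σ∈ with two σ σ∈
      ... | j , k , j≢k , j∈ , k∈ = begin
        suc (suc m)                                    ≤⟨ +-mono-≤ {1} (s≤s z≤n) ≤-refl ⟩
        suc m + suc m                                  ≤⟨ +-mono-≤ (length-descendants> m j∈) (length-descendants> m k∈) ⟩
        length (descendants m (σ ∷ʳ j)) + length (descendants m (σ ∷ʳ k))  ≤⟨ length²≤-concatMap _ j≢k (kids-complete j∈) (kids-complete k∈) ⟩
        length (descendants (suc m) σ)                           ∎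
        where open ≤-Reasoning

      level-mono : ∀ {m n} → m ≤ n → length (descendants m []) ≤ length (descendants n [])
      level-mono {m} {n} m≤n = subst (λ n → length (descendants m []) ≤ length (descendants n [])) (m∸n+n≡m m≤n) (go (n ℕ.∸ m))
        where
        go : ∀ d → length (descendants m []) ≤ length (descendants (d + m) [])
        go zero    = ≤-refl
        go (suc d) = ≤-trans (go d) (length-descendants-mono (d + m) []∈)

    module Leafless (noLeaves : NoLeaves S) where

      extend : ∀ {σ} → σ ∈ S → ∃ λ f → InfinitePath S f × Through σ f
      extend {σ} σ∈ =
        let (f , through , path) = limit-path (λ _ → S) (λ _ σ σ∈ → let (k , σk∈) = noLeaves σ σ∈ in k , [] , σk∈) σ σ∈
        in f , (λ j → let (n , j≤n , f∈) = path j in prefix∈ j≤n f∈) , through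

      node : ∀ n → ∃ (OfLength S n)
      node n = let (f , f∈ , _) = extend []∈ in f ↾ n , f∈ n , length-applyUpTo f n

    -- Uniformly branching trees: level sizes, compactness and category.

    module Uniform (finite : FinitelyBranching S) (noLeaves : NoLeaves S) (uniform : UniformlyBranching S) where

      open FinitelyBranchingTree finite public
      open Leafless noLeaves public

      b : ℕ → ℕ
      b n = length (kids (proj₁ (node n)))

      length-kids : ∀ {σ} → σ ∈ S → length (kids σ) ≡ b (length σ)
      length-kids {σ} σ∈ = HasCard-unique (card σ∈)
        (Equivalence.from (uniform σ (proj₁ (node n)) σ∈ (proj₁ (proj₂ (node n))) (sym (proj₂ (proj₂ (node n)))) _) (card (proj₁ (proj₂ (node n)))))
        where
        n = length σ
        card : ∀ {σ} → σ ∈ S → HasCard (Successor S σ) (length (kids σ))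
        card {σ} σ∈ = kids σ , refl , kids-card σ∈

      -- The product of the branching numbers of the `m` levels from `n` on.
      growth : ℕ → ℕ → ℕ
      growth n zero    = 1
      growth n (suc m) = b n * growth (suc n) m

      length-descendants : ∀ m {σ} → σ ∈ S → length (descendants m σ) ≡ growth (length σ) m
      length-descendants zero    σ∈ = refl
      length-descendants (suc m) {σ} σ∈ = trans
        (length-concatMap-const _ _ (kids σ) λ k k∈ → trans (length-descendants m (kids-sound σ∈ k∈)) (cong (λ n → growth n m) (trans (length-++ σ) (+-comm _ 1))))
        (cong (_* growth (suc (length σ)) m) (length-kids σ∈))

      growth-+ : ∀ a n m → growth a n * growth (a + n) m ≡ growth a (n + m)
      growth-+ a zero    m = trans (+-identityʳ _) (cong (λ k → growth k m) (+-identityʳ a))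
      growth-+ a (suc n) m = trans (*-assoc (b a) _ _) (cong (b a *_)
        (trans (cong (λ k → growth (suc a) n * growth k m) (+-suc a n)) (growth-+ (suc a) n m)))

      size : ℕ → ℕ
      size n = length (descendants n [])

      -- This is how uniform branching is used later: every node of length `n` has the same share, 1
      -- in `size n`, of each deeper level. This share is the mass of its cylinder.
      size*length-descendants : ∀ {σ} m → σ ∈ S → size (length σ) * length (descendants m σ) ≡ size (length σ + m)
      size*length-descendants {σ} m σ∈ = trans (cong₂ _*_ (length-descendants (length σ) []∈) (length-descendants m σ∈))
        (trans (growth-+ 0 (length σ) m) (sym (length-descendants (length σ + m) []∈)))

      1≤size : ∀ n → 1 ≤ size n
      1≤size n = let (ρ , ρ∈ , len) = node n in
        unique-⊆⇒length≤ {xs = ρ ∷ []} ([] ∷ [])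
          λ { (here refl) → subst (λ n → ρ ∈ˡ descendants n []) len (descendants-complete [] ρ ρ∈) }

      private
        HitWithin : (ℕ → Pred (ℕ → ℕ) 0ℓ) → List ℕ → ℕ → Set
        HitWithin hit σ K = ∀ f → InfinitePath S f → Through σ f → ∃ λ i → i < K × hit i f

      -- König's lemma: a string without a finite subcover has a successor without one.
      finite-subcover : (hit : ℕ → Pred (ℕ → ℕ) 0ℓ) (n : ℕ → ℕ) →
                        (∀ i {f g} → f ↾ n i ≡ g ↾ n i → hit i f → hit i g) →
                        (∀ f → InfinitePath S f → ∃ λ i → hit i f) →
                        ∃ λ K → ∀ f → InfinitePath S f → ∃ λ i → i < K × hit i f
      finite-subcover hit n open′ cover with lem {P = ∃ (HitWithin hit [])}
      ... | yes (K , c) = K , λ f f∈ → c f f∈ refl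
      ... | no ¬C[]     = contradiction f-covered (proj₂ Qf)
        where
        C = HitWithin hit

        Q : ℕ → Pred (List ℕ) 0ℓ
        Q _ σ = σ ∈ S × ¬ ∃ (C σ)

        step : ∀ j σ → Q j σ → ∃₂ λ k ρ → Q (suc j) (σ ++ k ∷ ρ)
        step j σ (σ∈ , ¬C) with lem {P = ∃ λ k → σ ∷ʳ k ∈ S × ¬ ∃ (C (σ ∷ʳ k))}
        ... | yes (k , q) = k , [] , q
        ... | no ¬q = contradiction (K , covered) ¬C
          where
          kid-covered : ∀ k → k ∈ˡ kids σ → ∃ (C (σ ∷ʳ k))
          kid-covered k k∈ with lem {P = ∃ (C (σ ∷ʳ k))}
          ... | yes c = c
          ... | no ¬c = contradiction (k , kids-sound σ∈ k∈ , ¬c) ¬q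

          bound = uniform-bound (λ k → C (σ ∷ʳ k))
            (λ k m≤n c f f∈ thr → let (i , i<m , h) = c f f∈ thr in i , <-≤-trans i<m m≤n , h) (kids σ) kid-covered
          K = proj₁ bound

          covered : C σ K
          covered f f∈ through = proj₂ bound (f (length σ)) (kids-complete (subst S through′ (f∈ (length σ + 1)))) f f∈
            (trans (cong (f ↾_) (length-++ σ)) through′)
            where
            through′ : f ↾ (length σ + 1) ≡ σ ∷ʳ f (length σ)
            through′ = trans (↾-+ f (length σ) 1) (cong₂ (λ τ l → τ ∷ʳ f l) through (+-identityʳ (length σ)))

        lim = limit-path Q step [] ([]∈ , ¬C[])
        f = proj₁ lim
        f∈ : InfinitePath S f
        f∈ j = let (m , j≤m , f∈S , _) = proj₂ (proj₂ lim) j in prefix∈ j≤m f∈S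
        i = proj₁ (cover f f∈)
        m = proj₁ (proj₂ (proj₂ lim) (n i))
        Qf : Q (n i) (f ↾ m)
        Qf = proj₂ (proj₂ (proj₂ (proj₂ lim) (n i)))
        f-covered : ∃ (C (f ↾ m))
        -- The limit path is hit by some `i`, and `hit i` depends on the first `n i` entries only.
        -- As `m` is at least `n i`, this single index covers all paths through `f ↾ m`.
        f-covered = suc i , λ g g∈ through → i , ≤-refl ,
          open′ i (↾-≤ (proj₁ (proj₂ (proj₂ (proj₂ lim) (n i))))
            (trans (sym through) (cong (g ↾_) (length-applyUpTo f m)))) (proj₂ (cover f f∈))

      -- Density in the cylinder of `σ`, in terms of strings. The witness `f` may leave `S`, because
      -- the sets covering `[S]` in the definition of packing measure are arbitrary.
      Dense : Pred (ℕ → ℕ) 0ℓ → List ℕ → Set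
      Dense X σ = ∀ μ → σ ++ μ ∈ S → ∃ λ f → f ∈ X × Through (σ ++ μ) f

      -- If no X j were dense in a cylinder, then a path could be built by lengthening a
      -- string so as to leave X 0, then X 1, and so on.
      baire : (X : ℕ → Pred (ℕ → ℕ) 0ℓ) → (∀ f → InfinitePath S f → ∃ λ j → f ∈ X j) →
              ∃₂ λ j σ → σ ∈ S × Dense (X j) σ
      baire X cover with lem {P = ∃₂ λ j σ → σ ∈ S × Dense (X j) σ}
      ... | yes p = p
      ... | no ¬dense = contradiction (f , proj₂ (cover f f∈) , through-↾ f m) (proj₂ Qf i ≤-refl)
        where
        Q : ℕ → Pred (List ℕ) 0ℓ
        Q j σ = σ ∈ S × (∀ i → i < j → ¬ ∃ λ f → f ∈ X i × Through σ f)

        extension : ∀ j σ → σ ∈ S → ∃ λ μ → σ ++ μ ∈ S × ¬ ∃ λ f → f ∈ X j × Through (σ ++ μ) f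
        extension j σ σ∈ with lem {P = ∃ λ μ → σ ++ μ ∈ S × ¬ ∃ λ f → f ∈ X j × Through (σ ++ μ) f}
        ... | yes p = p
        ... | no ¬p = contradiction (j , σ , σ∈ , dense) ¬dense
          where
          dense : Dense (X j) σ
          dense μ σμ∈ with lem {P = ∃ λ f → f ∈ X j × Through (σ ++ μ) f}
          ... | yes p = p
          ... | no ¬f = contradiction (μ , σμ∈ , ¬f) ¬p

        -- The extension `μ` that avoids `X j` may be empty. A further entry `k` makes the step
        -- proper, and `split` brings it into the form that `limit-path` asks for.
        split : ∀ (μ : List ℕ) k → ∃₂ λ k′ ρ → μ ∷ʳ k ≡ k′ ∷ ρ
        split []      k = k , [] , refl
        split (x ∷ μ) k = x , μ ∷ʳ k , refl

        step : ∀ j σ → Q j σ → ∃₂ λ k ρ → Q (suc j) (σ ++ k ∷ ρ)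
        step j σ (σ∈ , avoid) with extension j σ σ∈
        ... | μ , σμ∈ , avoidⱼ with noLeaves (σ ++ μ) σμ∈
        ...   | k , σμk∈ with split μ k
        ...     | k′ , ρ , eq = k′ , ρ , subst S shape σμk∈ , λ i i≤j (f , f∈ , through) →
          let through′ = subst (λ τ → Through τ f) (sym shape) through
          in [ (λ i<j → avoid i i<j (f , f∈ , through-++ σ through))
             , (λ { refl → avoidⱼ (f , f∈ , through-++ (σ ++ μ) through′) })
             ]′ (m≤n⇒m<n∨m≡n (s≤s⁻¹ i≤j))
          where
          shape : (σ ++ μ) ∷ʳ k ≡ σ ++ k′ ∷ ρ
          shape = trans (++-assoc σ μ _) (cong (σ ++_) eq)

        lim = limit-path Q step [] ([]∈ , λ _ ())
        f = proj₁ lim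
        f∈ : InfinitePath S f
        f∈ j = let (m , j≤m , f∈S , _) = proj₂ (proj₂ lim) j in prefix∈ j≤m f∈S
        i = proj₁ (cover f f∈)
        -- Stage `suc i`, not `i`, is the first whose string is known to avoid `X i`.
        m = proj₁ (proj₂ (proj₂ lim) (suc i))
        Qf : Q (suc i) (f ↾ m)
        Qf = proj₂ (proj₂ (proj₂ (proj₂ lim) (suc i)))

  finitelyBranching-⊆ : Classical → ∀ {S T} → IsTree S → S ⊆ T → FinitelyBranching T → FinitelyBranching S
  finitelyBranching-⊆ lem {S} {T} isTree S⊆T finite σ σ∈ with finite σ (S⊆T σ∈)
  ... | _ , xs , _ , xs! , xs⇔ = _ , filter inS xs , refl , Unique.filter⁺ inS xs! , λ k → mk⇔
    (λ σk∈ → ∈-filter⁺ inS (Equivalence.to (xs⇔ k) (S⊆T σk∈)) σk∈)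
    (λ k∈ → proj₂ (∈-filter⁻ inS {xs = xs} k∈))
    where
    inS : ∀ k → Dec (Successor S σ k)
    inS k = lem

open Combinatorics

-- Ordered field arithmetic, exponential, logarithm and powers.

module RealProperties (lem : Classical) (R : Reals) where

  open Reals R
  open ExtendedReals lem R using (fromℕ)
  open CommutativeRing commutativeRing public
    using (+-cong; +-congˡ; +-congʳ; *-cong; *-congˡ; *-congʳ; +-comm; *-comm; +-assoc; *-assoc;
           +-identityˡ; +-identityʳ; *-identityˡ; *-identityʳ; -‿inverseʳ; -‿inverseˡ; -‿cong;
           zeroˡ; zeroʳ; distribˡ; distribʳ; _-_)
    renaming (refl to ≈-refl; sym to ≈-sym; trans to ≈-trans; reflexive to ≈-reflexive)
  open RingProperties (CommutativeRing.ring commutativeRing) using (-‿distribˡ-*; -‿distribʳ-*; -‿involutive)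
  open IsTotalOrder isTotalOrder public using (antisym; total)
    renaming (refl to ≤-refl; trans to ≤-trans; reflexive to ≤-reflexive)
  open CommutativeSemigroupProperties (CommutativeRing.*-commutativeSemigroup commutativeRing) public
    using () renaming (xy∙z≈xz∙y to xy*z≈xz*y)
  open CommutativeSemigroupProperties (CommutativeRing.+-commutativeSemigroup commutativeRing) public
    using () renaming (interchange to +-interchange)
  open Mult semiring using (×-homo-+; ×1-homo-*)

  ≤-totalOrder : TotalOrder 0ℓ 0ℓ 0ℓ
  ≤-totalOrder = record { isTotalOrder = isTotalOrder }

  open PartialOrderReasoning (TotalOrder.poset ≤-totalOrder)

  <⇒≱ : ∀ {x y} → x < y → ¬ (y ≤ x)
  <⇒≱ = NonStrictToStrict.<⇒≱ _≈_ _≤_ antisym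

  x+y-y≈x : ∀ x y → (x + y) - y ≈ x
  x+y-y≈x x y = begin-equality
    (x + y) - y    ≈⟨ +-assoc x y (- y) ⟩
    x + (y - y)    ≈⟨ +-congˡ (-‿inverseʳ y) ⟩
    x + 0#         ≈⟨ +-identityʳ x ⟩
    x              ∎

  x-y+y≈x : ∀ x y → (x - y) + y ≈ x
  x-y+y≈x x y = begin-equality
    (x - y) + y    ≈⟨ +-assoc x (- y) y ⟩
    x + (- y + y)  ≈⟨ +-congˡ (-‿inverseˡ y) ⟩
    x + 0#         ≈⟨ +-identityʳ x ⟩
    x              ∎

  ≤-<-trans : ∀ {x y z} → x ≤ y → y < z → x < z
  ≤-<-trans x≤y y<z = begin-strict _ ≤⟨ x≤y ⟩ _ <⟨ y<z ⟩ _ ∎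

  <-≤-trans : ∀ {x y z} → x < y → y ≤ z → x < z
  <-≤-trans x<y y≤z = begin-strict _ <⟨ x<y ⟩ _ ≤⟨ y≤z ⟩ _ ∎

  ≰⇒> : ∀ {x y} → ¬ (x ≤ y) → y < x
  ≰⇒> {x} {y} x≰y with total x y
  ... | inj₁ x≤y = ⊥-elim (x≰y x≤y)
  ... | inj₂ y≤x = y≤x , λ y≈x → x≰y (≤-reflexive (≈-sym y≈x))

  ≤-or-> : ∀ x y → x ≤ y ⊎ y < x
  ≤-or-> x y with lem {P = x ≤ y}
  ... | yes x≤y = inj₁ x≤y
  ... | no x≰y  = inj₂ (≰⇒> x≰y)

  0<⇒≉0 : ∀ {x} → 0# < x → ¬ (x ≈ 0#)
  0<⇒≉0 (_ , 0≉x) x≈0 = 0≉x (≈-sym x≈0)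

  +-monoʳ-≤ : ∀ {x y} z → x ≤ y → z + x ≤ z + y
  +-monoʳ-≤ {x} {y} z x≤y = begin
    z + x  ≈⟨ +-comm z x ⟩
    x + z  ≤⟨ +-monoˡ-≤ z x≤y ⟩
    y + z  ≈⟨ +-comm y z ⟩
    z + y  ∎

  +-mono-≤ : ∀ {x y u v} → x ≤ y → u ≤ v → x + u ≤ y + v
  +-mono-≤ {y = y} {u} x≤y u≤v = ≤-trans (+-monoˡ-≤ u x≤y) (+-monoʳ-≤ y u≤v)

  +-cancelʳ-≤ : ∀ z {x y} → x + z ≤ y + z → x ≤ y
  +-cancelʳ-≤ z {x} {y} le = begin
    x            ≈⟨ x+y-y≈x x z ⟨
    (x + z) - z  ≤⟨ +-monoˡ-≤ (- z) le ⟩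
    (y + z) - z  ≈⟨ x+y-y≈x y z ⟩
    y            ∎

  +-monoˡ-< : ∀ {x y} z → x < y → x + z < y + z
  +-monoˡ-< z x<y = ≰⇒> λ le → <⇒≱ x<y (+-cancelʳ-≤ z le)

  ≤⇒0≤- : ∀ {x y} → x ≤ y → 0# ≤ y - x
  ≤⇒0≤- {x} {y} x≤y = +-cancelʳ-≤ x (begin
    0# + x       ≈⟨ +-identityˡ x ⟩
    x            ≤⟨ x≤y ⟩
    y            ≈⟨ x-y+y≈x y x ⟨
    (y - x) + x  ∎)

  <⇒0<- : ∀ {x y} → x < y → 0# < y - x
  <⇒0<- {x} {y} x<y = ≰⇒> λ le → <⇒≱ x<y (begin
    y            ≈⟨ x-y+y≈x y x ⟨
    (y - x) + x  ≤⟨ +-monoˡ-≤ x le ⟩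
    0# + x       ≈⟨ +-identityˡ x ⟩
    x            ∎)

  *-monoˡ-≤ : ∀ {x y z} → 0# ≤ z → x ≤ y → x * z ≤ y * z
  *-monoˡ-≤ {x} {y} {z} 0≤z x≤y = begin
    x * z                ≈⟨ +-identityˡ _ ⟨
    0# + x * z           ≤⟨ +-monoˡ-≤ (x * z) (*-nonneg (≤⇒0≤- x≤y) 0≤z) ⟩
    (y - x) * z + x * z  ≈⟨ distribʳ z (y - x) x ⟨
    ((y - x) + x) * z    ≈⟨ *-congʳ (x-y+y≈x y x) ⟩
    y * z                ∎

  *-monoʳ-≤ : ∀ {x y z} → 0# ≤ z → x ≤ y → z * x ≤ z * y
  *-monoʳ-≤ {x} {y} {z} 0≤z x≤y = begin
    z * x  ≈⟨ *-comm z x ⟩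
    x * z  ≤⟨ *-monoˡ-≤ 0≤z x≤y ⟩
    y * z  ≈⟨ *-comm y z ⟩
    z * y  ∎

  *-mono-≤ : ∀ {x y u v} → 0# ≤ x → 0# ≤ v → x ≤ y → u ≤ v → x * u ≤ y * v
  *-mono-≤ 0≤x 0≤v x≤y u≤v = ≤-trans (*-monoʳ-≤ 0≤x u≤v) (*-monoˡ-≤ 0≤v x≤y)

  0<1 : 0# < 1#
  0<1 = 0≤1 , 0≉1
    where
    0≤1 : 0# ≤ 1#
    0≤1 with total 0# 1#
    ... | inj₁ le = le
    ... | inj₂ 1≤0 = begin
      0#             ≤⟨ *-nonneg 0≤-1 0≤-1 ⟩
      - 1# * - 1#    ≈⟨ -‿distribˡ-* 1# (- 1#) ⟨
      - (1# * - 1#)  ≈⟨ -‿cong (*-identityˡ _) ⟩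
      - (- 1#)       ≈⟨ -‿involutive 1# ⟩
      1#             ∎
      where
      0≤-1 : 0# ≤ - 1#
      0≤-1 = ≤-trans (≤⇒0≤- 1≤0) (≤-reflexive (+-identityˡ _))

  0≤1 : 0# ≤ 1#
  0≤1 = proj₁ 0<1

  *-inverseˡ : ∀ {x} → 0# < x → x ⁻¹ * x ≈ 1#
  *-inverseˡ 0<x = ≈-trans (*-comm _ _) (*-inverseʳ (0<⇒≉0 0<x))

  0<⁻¹ : ∀ {x} → 0# < x → 0# < x ⁻¹
  0<⁻¹ {x} 0<x = ≰⇒> λ x⁻¹≤0 → <⇒≱ 0<1 (begin
    1#        ≈⟨ *-inverseˡ 0<x ⟨
    x ⁻¹ * x  ≤⟨ *-monoˡ-≤ (proj₁ 0<x) x⁻¹≤0 ⟩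
    0# * x    ≈⟨ zeroˡ x ⟩
    0#        ∎)

  *-cancelʳ-≤ : ∀ {x y z} → 0# < z → x * z ≤ y * z → x ≤ y
  *-cancelʳ-≤ {x} {y} {z} 0<z le = begin
    x               ≈⟨ eq x ⟩
    x * z * z ⁻¹    ≤⟨ *-monoˡ-≤ (proj₁ (0<⁻¹ 0<z)) le ⟩
    y * z * z ⁻¹    ≈⟨ eq y ⟨
    y               ∎
    where
    eq : ∀ w → w ≈ w * z * z ⁻¹
    eq w = begin-equality
      w               ≈⟨ *-identityʳ w ⟨
      w * 1#          ≈⟨ *-congˡ (*-inverseʳ (0<⇒≉0 0<z)) ⟨
      w * (z * z ⁻¹)  ≈⟨ *-assoc w z _ ⟨
      w * z * z ⁻¹    ∎

  *-monoˡ-< : ∀ {x y z} → 0# < z → x < y → x * z < y * z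
  *-monoˡ-< 0<z x<y = ≰⇒> λ le → <⇒≱ x<y (*-cancelʳ-≤ 0<z le)

  0<* : ∀ {x y} → 0# < x → 0# < y → 0# < x * y
  0<* {x} {y} 0<x 0<y = begin-strict
    0#      ≈⟨ zeroˡ y ⟨
    0# * y  <⟨ *-monoˡ-< 0<y 0<x ⟩
    x * y   ∎

  0<+ : ∀ {x y} → 0# ≤ x → 0# < y → 0# < x + y
  0<+ {x} {y} 0≤x 0<y = begin-strict
    0#      <⟨ 0<y ⟩
    y       ≈⟨ +-identityˡ y ⟨
    0# + y  ≤⟨ +-monoˡ-≤ y 0≤x ⟩
    x + y   ∎

  x≤x+y : ∀ x {y} → 0# ≤ y → x ≤ x + y
  x≤x+y x {y} 0≤y = begin
    x       ≈⟨ +-identityʳ x ⟨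
    x + 0#  ≤⟨ +-monoʳ-≤ x 0≤y ⟩
    x + y   ∎

  x≤y+x : ∀ x {y} → 0# ≤ y → x ≤ y + x
  x≤y+x x 0≤y = ≤-trans (x≤x+y x 0≤y) (≤-reflexive (+-comm x _))

  0≤+ : ∀ {x y} → 0# ≤ x → 0# ≤ y → 0# ≤ x + y
  0≤+ 0≤x 0≤y = ≤-trans 0≤x (x≤x+y _ 0≤y)

  ⁻¹-anti-≤ : ∀ {x y} → 0# < x → x ≤ y → y ⁻¹ ≤ x ⁻¹
  ⁻¹-anti-≤ {x} {y} 0<x x≤y = *-cancelʳ-≤ 0<y (begin
    y ⁻¹ * y  ≈⟨ *-inverseˡ 0<y ⟩
    1#        ≈⟨ *-inverseˡ 0<x ⟨
    x ⁻¹ * x  ≤⟨ *-monoʳ-≤ (proj₁ (0<⁻¹ 0<x)) x≤y ⟩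
    x ⁻¹ * y  ∎)
    where 0<y = <-≤-trans 0<x x≤y

  ½ : ℝ
  ½ = (1# + 1#) ⁻¹

  0<2 : 0# < 1# + 1#
  0<2 = 0<+ 0≤1 0<1

  0<½ : 0# < ½
  0<½ = 0<⁻¹ 0<2

  ½+½≈1 : ½ + ½ ≈ 1#
  ½+½≈1 = begin-equality
    ½ + ½            ≈⟨ +-cong (*-identityˡ ½) (*-identityˡ ½) ⟨
    1# * ½ + 1# * ½  ≈⟨ distribʳ ½ 1# 1# ⟨
    (1# + 1#) * ½    ≈⟨ *-inverseʳ (0<⇒≉0 0<2) ⟩
    1#               ∎

  x½+x½≈x : ∀ x → x * ½ + x * ½ ≈ x
  x½+x½≈x x = begin-equality
    x * ½ + x * ½  ≈⟨ distribˡ x ½ ½ ⟨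
    x * (½ + ½)    ≈⟨ *-congˡ ½+½≈1 ⟩
    x * 1#         ≈⟨ *-identityʳ x ⟩
    x              ∎

  <-dense : ∀ {x y} → x < y → ∃ λ z → x < z × z < y
  <-dense {x} {y} x<y = x * ½ + y * ½
    , (begin-strict
        x              ≈⟨ x½+x½≈x x ⟨
        x * ½ + x * ½  <⟨ +-monoʳ-< ⟩
        x * ½ + y * ½  ∎)
    , (begin-strict
        x * ½ + y * ½  <⟨ +-monoˡ-< (y * ½) x½<y½ ⟩
        y * ½ + y * ½  ≈⟨ x½+x½≈x y ⟩
        y              ∎)
    where
    x½<y½ = *-monoˡ-< 0<½ x<y
    +-monoʳ-< : x * ½ + x * ½ < x * ½ + y * ½
    +-monoʳ-< = begin-strict
      x * ½ + x * ½  <⟨ +-monoˡ-< (x * ½) x½<y½ ⟩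
      y * ½ + x * ½  ≈⟨ +-comm _ _ ⟩
      x * ½ + y * ½  ∎

  min : ∀ x y → 0# < x → 0# < y → ∃ λ z → 0# < z × z ≤ x × z ≤ y
  min x y 0<x 0<y with total x y
  ... | inj₁ x≤y = x , 0<x , ≤-refl , x≤y
  ... | inj₂ y≤x = y , 0<y , y≤x , ≤-refl

  0≤fromℕ : ∀ n → 0# ≤ fromℕ n
  0≤fromℕ zero    = ≤-refl
  0≤fromℕ (suc n) = 0≤+ 0≤1 (0≤fromℕ n)

  fromℕ-mono : ∀ {m n} → m ℕ.≤ n → fromℕ m ≤ fromℕ n
  fromℕ-mono {n = n} ℕ.z≤n = 0≤fromℕ n
  fromℕ-mono (ℕ.s≤s m≤n)   = +-monoʳ-≤ 1# (fromℕ-mono m≤n)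

  1≤fromℕ : ∀ {n} → 1 ℕ.≤ n → 1# ≤ fromℕ n
  1≤fromℕ 1≤n = ≤-trans (≤-reflexive (≈-sym (+-identityʳ 1#))) (fromℕ-mono 1≤n)

  0<fromℕ : ∀ {n} → 1 ℕ.≤ n → 0# < fromℕ n
  0<fromℕ 1≤n = <-≤-trans 0<1 (1≤fromℕ 1≤n)

  fromℕ-+ : ∀ m n → fromℕ (m ℕ.+ n) ≈ fromℕ m + fromℕ n
  fromℕ-+ = ×-homo-+ 1#

  fromℕ-* : ∀ m n → fromℕ (m ℕ.* n) ≈ fromℕ m * fromℕ n
  fromℕ-* = ×1-homo-*

  -- If the natural numbers were bounded, they would have a supremum `u`; as they are closed under
  -- successor, `u - 1#` would bound them too.
  archimedean : ∀ x → ∃ λ n → x ≤ fromℕ n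
  archimedean x with lem {P = ∃ λ n → x ≤ fromℕ n}
  ... | yes p = p
  ... | no ¬p = ⊥-elim (<⇒≱ 0<1 1≤0)
    where
    IsNat = λ y → ∃ λ n → y ≈ fromℕ n
    bounded : UpperBound IsNat x
    bounded y (n , y≈n) = ≤-trans (≤-reflexive y≈n) (proj₁ (≰⇒> λ x≤n → ¬p (n , x≤n)))
    lub = complete IsNat (0# , 0 , ≈-refl) (x , bounded)
    u = proj₁ lub
    u≤u-1 : u ≤ u - 1#
    u≤u-1 = proj₂ (proj₂ lub) (u - 1#) λ y (n , y≈n) → +-cancelʳ-≤ 1# (begin
      y + 1#            ≈⟨ +-comm y 1# ⟩
      1# + y            ≤⟨ proj₁ (proj₂ lub) (1# + y) (suc n , +-congˡ y≈n) ⟩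
      u                 ≈⟨ x-y+y≈x u 1# ⟨
      (u - 1#) + 1#     ∎)
    1≤0 : 1# ≤ 0#
    1≤0 = +-cancelʳ-≤ u (begin
      1# + u         ≤⟨ +-monoʳ-≤ 1# u≤u-1 ⟩
      1# + (u - 1#)  ≈⟨ +-comm _ _ ⟩
      (u - 1#) + 1#  ≈⟨ x-y+y≈x u 1# ⟩
      u              ≈⟨ +-identityˡ u ⟨
      0# + u         ∎)

  exp0≈1 : exp 0# ≈ 1#
  exp0≈1 = begin-equality
    exp 0#                        ≈⟨ *-identityʳ _ ⟨
    exp 0# * 1#                   ≈⟨ *-congˡ (*-inverseʳ (0<⇒≉0 0<e)) ⟨
    exp 0# * (exp 0# * exp 0# ⁻¹) ≈⟨ *-assoc _ _ _ ⟨
    exp 0# * exp 0# * exp 0# ⁻¹   ≈⟨ *-congʳ (exp-+ 0# 0#) ⟨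
    exp (0# + 0#) * exp 0# ⁻¹     ≈⟨ *-congʳ (exp-cong (+-identityʳ 0#)) ⟩
    exp 0# * exp 0# ⁻¹            ≈⟨ *-inverseʳ (0<⇒≉0 0<e) ⟩
    1#                            ∎
    where
    0<e : 0# < exp 0#
    0<e = <-≤-trans 0<1 (≤-trans (≤-reflexive (≈-sym (+-identityʳ 1#))) (1+x≤exp 0#))

  exp-inverse : ∀ x → exp x * exp (- x) ≈ 1#
  exp-inverse x = begin-equality
    exp x * exp (- x)  ≈⟨ exp-+ x (- x) ⟨
    exp (x - x)        ≈⟨ exp-cong (-‿inverseʳ x) ⟩
    exp 0#             ≈⟨ exp0≈1 ⟩
    1#                 ∎

  0<exp : ∀ x → 0# < exp x
  0<exp x with total 0# x
  ... | inj₁ 0≤x = <-≤-trans (<-≤-trans 0<1 (x≤x+y 1# 0≤x)) (1+x≤exp x)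
  ... | inj₂ x≤0 = ≰⇒> λ e≤0 → <⇒≱ 0<1 (begin
    1#                 ≈⟨ exp-inverse x ⟨
    exp x * exp (- x)  ≤⟨ *-monoˡ-≤ (≤-trans (≤-trans 0≤1 (x≤x+y 1# 0≤-x)) (1+x≤exp (- x))) e≤0 ⟩
    0# * exp (- x)     ≈⟨ zeroˡ _ ⟩
    0#                 ∎)
    where
    0≤-x : 0# ≤ - x
    0≤-x = ≤-trans (≤⇒0≤- x≤0) (≤-reflexive (+-identityˡ _))

  exp-mono-< : ∀ {x y} → x < y → exp x < exp y
  exp-mono-< {x} {y} x<y = begin-strict
    exp x                      ≈⟨ *-identityˡ _ ⟨
    1# * exp x                 <⟨ *-monoˡ-< (0<exp x) 1<1+ ⟩
    (1# + (y - x)) * exp x     ≤⟨ *-monoˡ-≤ (proj₁ (0<exp x)) (1+x≤exp _) ⟩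
    exp (y - x) * exp x        ≈⟨ exp-+ _ _ ⟨
    exp ((y - x) + x)          ≈⟨ exp-cong (x-y+y≈x y x) ⟩
    exp y                      ∎
    where
    1<1+ : 1# < 1# + (y - x)
    1<1+ = begin-strict
      1#            ≈⟨ +-identityˡ 1# ⟨
      0# + 1#       <⟨ +-monoˡ-< 1# (<⇒0<- x<y) ⟩
      (y - x) + 1#  ≈⟨ +-comm _ _ ⟩
      1# + (y - x)  ∎

  exp-cancel-≤ : ∀ {x y} → exp x ≤ exp y → x ≤ y
  exp-cancel-≤ {x} {y} le with ≤-or-> x y
  ... | inj₁ x≤y = x≤y
  ... | inj₂ y<x = ⊥-elim (<⇒≱ (exp-mono-< y<x) le)

  exp-mono-≤ : ∀ {x y} → x ≤ y → exp x ≤ exp y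
  exp-mono-≤ {x} {y} x≤y with ≤-or-> (exp x) (exp y)
  ... | inj₁ le = le
  ... | inj₂ gt = ⊥-elim (proj₂ gt (exp-cong (antisym (exp-cancel-≤ (proj₁ gt)) x≤y)))

  log-mono-≤ : ∀ {x y} → 0# < x → x ≤ y → log x ≤ log y
  log-mono-≤ {x} {y} 0<x x≤y = exp-cancel-≤ (begin
    exp (log x)  ≈⟨ exp-log 0<x ⟩
    x            ≤⟨ x≤y ⟩
    y            ≈⟨ exp-log (<-≤-trans 0<x x≤y) ⟨
    exp (log y)  ∎)

  log-cong : ∀ {x y} → 0# < x → x ≈ y → log x ≈ log y
  log-cong 0<x x≈y = antisym (log-mono-≤ 0<x (≤-reflexive x≈y))
    (log-mono-≤ (<-≤-trans 0<x (≤-reflexive x≈y)) (≤-reflexive (≈-sym x≈y)))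

  log1≈0 : log 1# ≈ 0#
  log1≈0 = antisym (exp-cancel-≤ (≤-reflexive eq)) (exp-cancel-≤ (≤-reflexive (≈-sym eq)))
    where
    eq : exp (log 1#) ≈ exp 0#
    eq = ≈-trans (exp-log 0<1) (≈-sym exp0≈1)

  log≤0 : ∀ {x} → 0# < x → x ≤ 1# → log x ≤ 0#
  log≤0 0<x x≤1 = ≤-trans (log-mono-≤ 0<x x≤1) (≤-reflexive log1≈0)

  0<log⁻¹ : ∀ {x} → 0# < x → x < 1# → 0# < log (x ⁻¹)
  0<log⁻¹ {x} 0<x x<1 = ≰⇒> λ le → <⇒≱ 1<x⁻¹ (begin
    x ⁻¹              ≈⟨ exp-log (0<⁻¹ 0<x) ⟨
    exp (log (x ⁻¹))  ≤⟨ exp-mono-≤ le ⟩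
    exp 0#            ≈⟨ exp0≈1 ⟩
    1#                ∎)
    where
    1<x⁻¹ : 1# < x ⁻¹
    1<x⁻¹ = begin-strict
      1#         ≈⟨ *-inverseʳ (0<⇒≉0 0<x) ⟨
      x * x ⁻¹   <⟨ *-monoˡ-< (0<⁻¹ 0<x) x<1 ⟩
      1# * x ⁻¹  ≈⟨ *-identityˡ _ ⟩
      x ⁻¹       ∎

  log-* : ∀ {x y} → 0# < x → 0# < y → log (x * y) ≈ log x + log y
  log-* {x} {y} 0<x 0<y = antisym (exp-cancel-≤ (≤-reflexive eq)) (exp-cancel-≤ (≤-reflexive (≈-sym eq)))
    where
    eq : exp (log (x * y)) ≈ exp (log x + log y)
    eq = begin-equality
      exp (log (x * y))          ≈⟨ exp-log (0<* 0<x 0<y) ⟩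
      x * y                      ≈⟨ *-cong (exp-log 0<x) (exp-log 0<y) ⟨
      exp (log x) * exp (log y)  ≈⟨ exp-+ _ _ ⟨
      exp (log x + log y)        ∎

  -- The real power for positive `x`; elsewhere it may depend on unspecified values of `log`. It
  -- avoids the case distinctions of `_^_`, to which `pow≤^` and `^≤pow` connect it.
  pow : ℝ → ℝ → ℝ
  pow x s = exp (s * log x)

  0<pow : ∀ x s → 0# < pow x s
  0<pow x s = 0<exp _

  0≤pow : ∀ x s → 0# ≤ pow x s
  0≤pow x s = proj₁ (0<pow x s)

  pow-+ : ∀ x s t → pow x (s + t) ≈ pow x s * pow x t
  pow-+ x s t = ≈-trans (exp-cong (distribʳ (log x) s t)) (exp-+ _ _)

  pow-split : ∀ x s t → pow x t ≈ pow x s * pow x (t - s)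
  pow-split x s t = ≈-trans (exp-cong (*-congʳ (≈-sym (≈-trans (+-comm _ _) (x-y+y≈x t s))))) (pow-+ x s (t - s))

  pow-monoˡ-≤ : ∀ {x y s} → 0# ≤ s → 0# < x → x ≤ y → pow x s ≤ pow y s
  pow-monoˡ-≤ 0≤s 0<x x≤y = exp-mono-≤ (*-monoʳ-≤ 0≤s (log-mono-≤ 0<x x≤y))

  pow-antiʳ-≤ : ∀ {x s t} → 0# < x → x ≤ 1# → s ≤ t → pow x t ≤ pow x s
  -- Subtracting both `t * log x` and `s * log x` turns the claim into `s ≤ t` multiplied by the
  -- nonnegative number `- log x`.
  pow-antiʳ-≤ {x} {s} {t} 0<x x≤1 s≤t = exp-mono-≤ (+-cancelʳ-≤ (- (t * log x) + - (s * log x)) (begin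
    t * log x + (- (t * log x) + - (s * log x))  ≈⟨ +-assoc _ _ _ ⟨
    (t * log x - t * log x) + - (s * log x)      ≈⟨ +-congʳ (-‿inverseʳ _) ⟩
    0# + - (s * log x)                           ≈⟨ +-identityˡ _ ⟩
    - (s * log x)                                ≈⟨ -‿distribʳ-* s (log x) ⟩
    s * - log x                                  ≤⟨ *-monoˡ-≤ 0≤-log s≤t ⟩
    t * - log x                                  ≈⟨ -‿distribʳ-* t (log x) ⟨
    - (t * log x)                                ≈⟨ x-y+y≈x _ (s * log x) ⟨
    (- (t * log x) - s * log x) + s * log x      ≈⟨ +-comm _ _ ⟩
    s * log x + (- (t * log x) + - (s * log x))  ∎))
    where
    0≤-log : 0# ≤ - log x
    0≤-log = ≤-trans (≤⇒0≤- (log≤0 0<x x≤1)) (≤-reflexive (+-identityˡ _))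

  -- With `s` the gap between two exponents, this makes the spare factor smaller than any given
  -- constant.
  pow-small : ∀ {s ε} → 0# < s → 0# < ε → ∃ λ δ → 0# < δ × (∀ x → 0# < x → x ≤ δ → pow x s ≤ ε)
  -- `exp L` is `ε` to the power `s ⁻¹`.
  pow-small {s} {ε} 0<s 0<ε = exp L , 0<exp L , λ x 0<x x≤δ → begin
    exp (s * log x)            ≤⟨ exp-mono-≤ (*-monoʳ-≤ (proj₁ 0<s) (exp-cancel-≤ (≤-trans (≤-reflexive (exp-log 0<x)) x≤δ))) ⟩
    exp (s * L)                ≈⟨ exp-cong eq ⟩
    exp (log ε)                ≈⟨ exp-log 0<ε ⟩
    ε                          ∎
    where
    L = s ⁻¹ * log ε
    eq : s * L ≈ log ε
    eq = begin-equality
      s * (s ⁻¹ * log ε)  ≈⟨ *-assoc _ _ _ ⟨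
      s * s ⁻¹ * log ε    ≈⟨ *-congʳ (*-inverseʳ (0<⇒≉0 0<s)) ⟩
      1# * log ε          ≈⟨ *-identityˡ _ ⟩
      log ε               ∎

  pow-* : ∀ {x y} s → 0# < x → 0# < y → pow (x * y) s ≈ pow x s * pow y s
  pow-* s 0<x 0<y = ≈-trans (exp-cong (≈-trans (*-congˡ (log-* 0<x 0<y)) (distribˡ s _ _))) (exp-+ _ _)

  pow-⁻¹ : ∀ {x} s → 0# < x → pow x s * pow (x ⁻¹) s ≈ 1#
  pow-⁻¹ {x} s 0<x = begin-equality
    pow x s * pow (x ⁻¹) s  ≈⟨ pow-* s 0<x (0<⁻¹ 0<x) ⟨
    exp (s * log (x * x ⁻¹))  ≈⟨ exp-cong (*-congˡ (log-cong (0<* 0<x (0<⁻¹ 0<x)) (*-inverseʳ (0<⇒≉0 0<x)))) ⟩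
    exp (s * log 1#)          ≈⟨ exp-cong (≈-trans (*-congˡ log1≈0) (zeroʳ s)) ⟩
    exp 0#                    ≈⟨ exp0≈1 ⟩
    1#                        ∎

-- Suprema, infima, sums and limits in the extended reals.

module ExtendedProperties (lem : Classical) (R : Reals) where

  open Reals R
  open ExtendedReals lem R 
  open RealProperties lem R
  open PartialOrderReasoning (TotalOrder.poset ≤-totalOrder)

  ≤⁺-refl : ∀ {x} → x ≤⁺ x
  ≤⁺-refl {⊤⁺}    = ⊤⁺ ≤⊤⁺
  ≤⁺-refl {[ x ]} = [ ≤-refl ]

  infixr 5 _⊚_
  _⊚_ : ∀ {x y z} → x ≤⁺ y → y ≤⁺ z → x ≤⁺ z
  _⊚_ = ≤⁺-trans ≤-trans

  ≤⁺-total : ∀ x y → x ≤⁺ y ⊎ y ≤⁺ x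
  ≤⁺-total = AddSupNonStrict.≤⁺-total _≤_ total

  ≤⁺-antisym : ∀ {x y} → x ≤⁺ y → y ≤⁺ x → x ≈⁺ y
  ≤⁺-antisym = AddSupNonStrict.≤⁺-antisym _≤_ antisym

  ≰⁺⇒≥ : ∀ {x y} → ¬ (x ≤⁺ y) → y ≤⁺ x
  ≰⁺⇒≥ {x} {y} x≰y = [ (λ x≤y → ⊥-elim (x≰y x≤y)) , (λ y≤x → y≤x) ]′ (≤⁺-total x y)

  ≤⁺⁻¹ : ∀ {x y} → [ x ] ≤⁺ [ y ] → x ≤ y
  ≤⁺⁻¹ = AddSupNonStrict.[≤]-injective _≤_

  ≈⁺⇒≤⁺ : ∀ {x y} → x ≈⁺ y → x ≤⁺ y
  ≈⁺⇒≤⁺ [ eq ] = [ ≤-reflexive eq ]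
  ≈⁺⇒≤⁺ ∙≈∙ = _ ≤⊤⁺

  ≈⁺⇒≥⁺ : ∀ {x y} → x ≈⁺ y → y ≤⁺ x
  ≈⁺⇒≥⁺ [ eq ] = [ ≤-reflexive (≈-sym eq) ]
  ≈⁺⇒≥⁺ ∙≈∙ = _ ≤⊤⁺

  <⇒≱⁺ : ∀ {x y} → x < y → ¬ ([ y ] ≤⁺ [ x ])
  <⇒≱⁺ x<y y≤x = <⇒≱ x<y (≤⁺⁻¹ y≤x)

  module _ {i} {I : Set i} (f : I → ℝ⁺) where

    0≤sup : 0⁺ ≤⁺ sup f
    0≤sup = proj₁ (proj₂ (sup-exists f))

    sup-upper : ∀ j → f j ≤⁺ sup f
    sup-upper = proj₁ (proj₂ (proj₂ (sup-exists f)))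

    sup-least : ∀ {v} → 0⁺ ≤⁺ v → (∀ j → f j ≤⁺ v) → sup f ≤⁺ v
    sup-least = proj₂ (proj₂ (proj₂ (sup-exists f))) _

  module _ {i} {I : Set i} (f : I → ℝ⁺) where

    0≤inf : 0⁺ ≤⁺ inf f
    0≤inf = 0≤sup _

    -- An infimum is a supremum of lower bounds taken in [0,∞], so it is at least 0 even if the
    -- family has negative members.
    inf-lower : ∀ j → 0⁺ ≤⁺ f j → inf f ≤⁺ f j
    inf-lower j 0≤f = sup-least _ 0≤f λ (_ , lower) → lower j

    inf-greatest : ∀ {v} → (∀ j → v ≤⁺ f j) → v ≤⁺ inf f
    inf-greatest lower = sup-upper proj₁ (_ , lower)

    inf-approx : ∀ {a b} → a < b → inf f ≤⁺ [ a ] → ∃ λ j → f j ≤⁺ [ b ]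
    inf-approx {a} {b} a<b inf≤a with lem {P = ∃ λ j → f j ≤⁺ [ b ]}
    ... | yes p = p
    ... | no ¬p = ⊥-elim (<⇒≱⁺ a<b (inf-greatest (λ j → ≰⁺⇒≥ λ le → ¬p (j , le)) ⊚ inf≤a))

    -- A supremum equal to 0 may be due to the convention for [0,∞] alone; `0# ≤ a` and `a < b`
    -- exclude this value.
    sup-approx : ∀ {a b} → 0# ≤ a → a < b → [ b ] ≤⁺ sup f → ∃ λ j → [ a ] ≤⁺ f j
    sup-approx {a} {b} 0≤a a<b b≤sup with lem {P = ∃ λ j → [ a ] ≤⁺ f j}
    ... | yes p = p
    ... | no ¬p = ⊥-elim (<⇒≱⁺ a<b (b≤sup ⊚ sup-least f [ 0≤a ] λ j → ≰⁺⇒≥ λ le → ¬p (j , le)))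

  -- All four inequalities between dimensions are obtained from this. A finite gap leaves room for
  -- intermediate exponents, and one exists even if `A` is infinite, above any finite `B`.
  ≤⁺-by-gap : ∀ A B → 0⁺ ≤⁺ B →
              (∀ s t → 0# ≤ s → s < t → B ≤⁺ [ s ] → [ t ] ≤⁺ A → ⊥) → A ≤⁺ B
  ≤⁺-by-gap A ⊤⁺ 0≤B no-gap = A ≤⊤⁺
  ≤⁺-by-gap ⊤⁺ [ b ] [ 0≤b ] no-gap = ⊥-elim (no-gap b (1# + b) 0≤b b<1+b ≤⁺-refl (_ ≤⊤⁺))
    where
    b<1+b : b < 1# + b
    b<1+b = begin-strict
      b       ≈⟨ +-identityˡ b ⟨
      0# + b  <⟨ +-monoˡ-< b 0<1 ⟩
      1# + b  ∎
  ≤⁺-by-gap [ a ] [ b ] [ 0≤b ] no-gap with ≤-or-> a b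
  ... | inj₁ a≤b = [ a≤b ]
  ... | inj₂ b<a = ⊥-elim (no-gap b a 0≤b b<a ≤⁺-refl ≤⁺-refl)

  pow-0 : ∀ x {s} → s ≈ 0# → pow x s ≈ 1#
  pow-0 x {s} s≈0 = begin-equality
    exp (s * log x)   ≈⟨ exp-cong (*-congʳ s≈0) ⟩
    exp (0# * log x)  ≈⟨ exp-cong (zeroˡ _) ⟩
    exp 0#            ≈⟨ exp0≈1 ⟩
    1#                ∎

  pow≤^ : ∀ {x} s → 0# < x → [ pow x s ] ≤⁺ [ x ] ^ s
  pow≤^ {x} s 0<x with lem {P = s ≈ 0#}
  ... | yes s≈0 = [ ≤-reflexive (pow-0 x s≈0) ]
  ... | no _ with lem {P = 0# < x}
  ...   | yes _  = ≤⁺-refl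
  ...   | no 0≮x = ⊥-elim (0≮x 0<x)

  ^≤pow : ∀ {a y s} → 0# ≤ s → 0# < y → a ≤⁺ [ y ] → a ^ s ≤⁺ [ pow y s ]
  ^≤pow {a} {y} {s} 0≤s 0<y a≤y with lem {P = s ≈ 0#}
  ... | yes s≈0 = [ ≤-reflexive (≈-sym (pow-0 y s≈0)) ]
  ^≤pow {[ x ]} {y} {s} 0≤s 0<y [ x≤y ] | no _ with lem {P = 0# < x}
  ... | yes 0<x = [ pow-monoˡ-≤ 0≤s 0<x x≤y ]
  ... | no _    = [ 0≤pow y s ]

  -- A diameter may be 0 and then has no level. A positive `α` above it costs at most `ε`: a
  -- positive diameter is kept, 0 is replaced by a number with small power if `s` is positive, and
  -- for `s ≈ 0#` both powers are 1, so that `δ` will do.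
  ^-approx : ∀ {a δ s ε} → 0⁺ ≤⁺ a → 0# < δ → a ≤⁺ [ δ ] → 0# ≤ s → 0# < ε →
             ∃ λ α → 0# < α × α ≤ δ × a ≤⁺ [ α ] × [ pow α s ] ≤⁺ (a ^ s) +⁺ [ ε ]
  ^-approx {[ x ]} {δ} {s} {ε} [ 0≤x ] 0<δ [ x≤δ ] 0≤s 0<ε with lem {P = s ≈ 0#}
  ... | yes s≈0 = δ , 0<δ , ≤-refl , [ x≤δ ] , [ ≤-trans (≤-reflexive (pow-0 δ s≈0)) (x≤x+y 1# (proj₁ 0<ε)) ]
  ... | no s≉0 with lem {P = 0# < x}
  ...   | yes 0<x = x , 0<x , x≤δ , ≤⁺-refl , [ x≤x+y _ (proj₁ 0<ε) ]
  ...   | no 0≮x  =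
    let (η , 0<η , small)   = pow-small (0≤s , λ 0≈s → s≉0 (≈-sym 0≈s)) 0<ε
        (α , 0<α , α≤δ , α≤η) = min δ η 0<δ 0<η
    in α , 0<α , α≤δ , [ ≤-trans x≤0 (proj₁ 0<α) ] , [ ≤-trans (small α 0<α α≤η) (x≤y+x ε ≤-refl) ]
    where
    x≤0 : x ≤ 0#
    x≤0 = [ (λ le → le) , (λ 0<x → ⊥-elim (0≮x 0<x)) ]′ (≤-or-> x 0#)

  sum : (ℕ → ℝ) → ℕ → ℝ
  sum w k = foldr _+_ 0# (applyUpTo w k)

  sum⁺ : (ℕ → ℝ⁺) → ℕ → ℝ⁺
  sum⁺ a k = foldr _+⁺_ 0⁺ (applyUpTo a k)

  +⁺-mono : ∀ {a b c d} → a ≤⁺ b → c ≤⁺ d → a +⁺ c ≤⁺ b +⁺ d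
  +⁺-mono [ p ]   [ q ]   = [ +-mono-≤ p q ]
  +⁺-mono [ p ]   (_ ≤⊤⁺) = _ ≤⊤⁺
  +⁺-mono (_ ≤⊤⁺) q       = _ ≤⊤⁺

  sum⁺-≤ : ∀ {a w} k → (∀ i → a i ≤⁺ [ w i ]) → sum⁺ a k ≤⁺ [ sum w k ]
  sum⁺-≤ zero    a≤w = ≤⁺-refl
  sum⁺-≤ (suc k) a≤w = +⁺-mono (a≤w 0) (sum⁺-≤ k λ i → a≤w (suc i))

  ≤-sum⁺+ : ∀ {a w e} k → (∀ i → [ w i ] ≤⁺ a i +⁺ [ e i ]) →
            [ sum w k ] ≤⁺ sum⁺ a k +⁺ [ sum e k ]
  ≤-sum⁺+ zero w≤a = [ x≤x+y 0# ≤-refl ]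
  ≤-sum⁺+ {a} {w} {e} (suc k) w≤a =
    +⁺-mono (w≤a 0) (≤-sum⁺+ {λ i → a (suc i)} k λ i → w≤a (suc i)) ⊚ interchange (a 0) (sum⁺ (λ i → a (suc i)) k)
    where
    interchange : ∀ x y {u v} → (x +⁺ [ u ]) +⁺ (y +⁺ [ v ]) ≤⁺ (x +⁺ y) +⁺ [ u + v ]
    interchange ⊤⁺    y      = _ ≤⊤⁺
    interchange [ x ] ⊤⁺     = _ ≤⊤⁺
    interchange [ x ] [ y ] {u} {v} = [ ≤-reflexive (+-interchange x u y v) ]

  x≤⁺x+y : ∀ {x y} → 0⁺ ≤⁺ y → x ≤⁺ x +⁺ y
  x≤⁺x+y {⊤⁺}    0≤y = _ ≤⊤⁺
  x≤⁺x+y {[ x ]} (_ ≤⊤⁺) = _ ≤⊤⁺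
  x≤⁺x+y {[ x ]} [ 0≤y ] = [ x≤x+y x 0≤y ]

  x≤⁺y+x : ∀ {x y} → 0⁺ ≤⁺ y → x ≤⁺ y +⁺ x
  x≤⁺y+x         (_ ≤⊤⁺) = _ ≤⊤⁺
  x≤⁺y+x {⊤⁺}    [ 0≤y ] = _ ≤⊤⁺
  x≤⁺y+x {[ x ]} [ 0≤y ] = [ x≤y+x x 0≤y ]

  term≤sum⁺ : ∀ {a} i → (∀ i → 0⁺ ≤⁺ a i) → a i ≤⁺ sum⁺ a (suc i)
  term≤sum⁺ zero    0≤a = x≤⁺x+y ≤⁺-refl
  term≤sum⁺ (suc i) 0≤a = term≤sum⁺ i (λ i → 0≤a (suc i)) ⊚ x≤⁺y+x (0≤a 0)

  term≤∑ : ∀ {a} i → (∀ i → 0⁺ ≤⁺ a i) → a i ≤⁺ ∑ a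
  term≤∑ {a} i 0≤a = term≤sum⁺ i 0≤a ⊚ sup-upper (sum⁺ a) (suc i)

  0≤∑ : ∀ a → 0⁺ ≤⁺ ∑ a
  0≤∑ a = 0≤sup (sum⁺ a)

  ∑-least : ∀ a {v} → 0⁺ ≤⁺ v → (∀ k → sum⁺ a k ≤⁺ v) → ∑ a ≤⁺ v
  ∑-least a = sup-least (sum⁺ a)

  sum⁺-zero : ∀ {a} k → (∀ i → a i ≤⁺ 0⁺) → sum⁺ a k ≤⁺ 0⁺
  sum⁺-zero zero    a≤0 = ≤⁺-refl
  sum⁺-zero (suc k) a≤0 = +⁺-mono (a≤0 0) (sum⁺-zero k λ i → a≤0 (suc i)) ⊚ [ ≤-reflexive (+-identityʳ 0#) ]

  ≤⁺0-by-ε : ∀ {A} → (∀ ε → 0# < ε → A ≤⁺ [ ε ]) → A ≤⁺ 0⁺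
  ≤⁺0-by-ε {⊤⁺} small with small 1# 0<1
  ... | ()
  ≤⁺0-by-ε {[ a ]} small with ≤-or-> a 0#
  ... | inj₁ a≤0 = [ a≤0 ]
  ... | inj₂ 0<a = let (ε , 0<ε , ε<a) = <-dense 0<a in ⊥-elim (<⇒≱⁺ ε<a (small ε 0<ε))

  sum-mono : ∀ {v w} k → (∀ i → i ℕ.< k → v i ≤ w i) → sum v k ≤ sum w k
  sum-mono zero    v≤w = ≤-refl
  sum-mono (suc k) v≤w = +-mono-≤ (v≤w 0 (ℕ.s≤s ℕ.z≤n)) (sum-mono k λ i i<k → v≤w (suc i) (ℕ.s≤s i<k))

  sum-*ˡ : ∀ c w k → sum (λ i → c * w i) k ≈ c * sum w k
  sum-*ˡ c w zero    = ≈-sym (zeroʳ c)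
  sum-*ˡ c w (suc k) = ≈-trans (+-congˡ (sum-*ˡ c (λ i → w (suc i)) k)) (≈-sym (distribˡ c _ _))

  -- The sequence c/2, c/4, c/8 and so on. Halving `c` in the recursive call makes the tail of a sum
  -- a sum of the same kind.
  geometric : ℝ → ℕ → ℝ
  geometric c zero    = c * ½
  geometric c (suc i) = geometric (c * ½) i

  0<geometric : ∀ {c} i → 0# < c → 0# < geometric c i
  0<geometric zero    0<c = 0<* 0<c 0<½
  0<geometric (suc i) 0<c = 0<geometric i (0<* 0<c 0<½)

  sum-geometric : ∀ {c} k → 0# ≤ c → sum (geometric c) k ≤ c
  sum-geometric zero        0≤c = 0≤c
  sum-geometric {c} (suc k) 0≤c = begin
    c * ½ + sum (geometric (c * ½)) k  ≤⟨ +-monoʳ-≤ (c * ½) (sum-geometric k (*-nonneg 0≤c (proj₁ 0<½))) ⟩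
    c * ½ + c * ½                      ≈⟨ x½+x½≈x c ⟩
    c                                  ∎

  module _ (F : ℝ → ℝ⁺) where

    private
      inf-F sup-F : (∃ λ δ → 0# < δ) → ℝ⁺
      inf-F (δ , _) = inf {I = ∃ λ α → 0# < α × α ≤ δ} λ (α , _) → F α
      sup-F (δ , _) = sup {I = ∃ λ α → 0# < α × α ≤ δ} λ (α , _) → F α

    -- This and the next three lemmas extract scales from bounds on limits: two yield some
    -- arbitrarily small `α`, the other two all small `α`. Each gives up a little of the bound,
    -- since the suprema and infima need not be attained.
    liminf₀≤⇒ : ∀ {s u} → s < u → liminf₀ F ≤⁺ [ s ] → ∀ {δ} → 0# < δ →
                ∃ λ α → 0# < α × α ≤ δ × F α ≤⁺ [ u ]
    liminf₀≤⇒ s<u lim≤s {δ} 0<δ =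
      let ((α , 0<α , α≤δ) , F≤u) = inf-approx _ s<u (sup-upper inf-F (δ , 0<δ) ⊚ lim≤s)
      in α , 0<α , α≤δ , F≤u

    ≤liminf₀⇒ : ∀ {w t} → 0# ≤ w → w < t → [ t ] ≤⁺ liminf₀ F →
                ∃ λ δ → 0# < δ × (∀ α → 0# < α → α ≤ δ → 0⁺ ≤⁺ F α → [ w ] ≤⁺ F α)
    ≤liminf₀⇒ 0≤w w<t t≤lim =
      let ((δ , 0<δ) , w≤inf) = sup-approx inf-F 0≤w w<t t≤lim
      in δ , 0<δ , λ α 0<α α≤δ 0≤F → w≤inf ⊚ inf-lower _ (α , 0<α , α≤δ) 0≤F

    limsup₀≤⇒ : ∀ {s u} → s < u → limsup₀ F ≤⁺ [ s ] →
                ∃ λ δ → 0# < δ × (∀ α → 0# < α → α ≤ δ → F α ≤⁺ [ u ])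
    limsup₀≤⇒ s<u lim≤s =
      let ((δ , 0<δ) , sup≤u) = inf-approx sup-F s<u lim≤s
      in δ , 0<δ , λ α 0<α α≤δ → sup-upper _ (α , 0<α , α≤δ) ⊚ sup≤u

    ≤limsup₀⇒ : ∀ {w t} → 0# ≤ w → w < t → [ t ] ≤⁺ limsup₀ F → ∀ {δ} → 0# < δ →
                ∃ λ α → 0# < α × α ≤ δ × [ w ] ≤⁺ F α
    ≤limsup₀⇒ 0≤w w<t t≤lim {δ} 0<δ =
      let ((α , 0<α , α≤δ) , w≤F) = sup-approx _ 0≤w w<t (t≤lim ⊚ inf-lower sup-F (δ , 0<δ) (0≤sup _))
      in α , 0<α , α≤δ , w≤F

  sum⁺-family-≤ : ∀ {a} {A : Set a} (g : A → ℝ⁺) {c} → 0# ≤ c → ∀ {k} (F : Fin k → A) → (∀ j → g (F j) ≤⁺ [ c ]) →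
                  ∀ K → sum⁺ (λ i → maybe g 0⁺ (family F i)) K ≤⁺ [ fromℕ k * c ]
  sum⁺-family-≤ g 0≤c {k} F g≤c zero = [ *-nonneg (0≤fromℕ k) 0≤c ]
  sum⁺-family-≤ g {c} 0≤c {zero} F g≤c (suc K) = sum⁺-zero (suc K) (λ _ → ≤⁺-refl) ⊚ [ ≤-reflexive (≈-sym (zeroˡ c)) ]
  sum⁺-family-≤ g {c} 0≤c {suc k} F g≤c (suc K) =
    +⁺-mono (g≤c Fin.zero) (sum⁺-family-≤ g 0≤c (F ∘ Fin.suc) (g≤c ∘ Fin.suc) K) ⊚ [ ≤-reflexive (suc-* k c) ]
    where
    suc-* : ∀ k c → c + fromℕ k * c ≈ fromℕ (suc k) * c
    suc-* k c = ≈-sym (≈-trans (distribʳ c _ _) (+-congʳ (*-identityˡ c)))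

  ≤-sum⁺-family : ∀ {a} {A : Set a} (g : A → ℝ⁺) {c} {k} (F : Fin k → A) → (∀ j → [ c ] ≤⁺ g (F j)) →
                  [ fromℕ k * c ] ≤⁺ sum⁺ (λ i → maybe g 0⁺ (family F i)) k
  ≤-sum⁺-family g {c} {zero}  F c≤g = [ ≤-reflexive (zeroˡ c) ]
  ≤-sum⁺-family g {c} {suc k} F c≤g =
    [ ≤-reflexive (≈-trans (distribʳ c _ _) (+-congʳ (*-identityˡ c))) ] ⊚
    +⁺-mono (c≤g Fin.zero) (≤-sum⁺-family g (F ∘ Fin.suc) (c≤g ∘ Fin.suc))

  module _ (Z : ℝ → ℝ⁺) where

    private
      exponent : (∃ λ s → 0# ≤ s × Z s ≈⁺ 0⁺) → ℝ⁺
      exponent (s , _) = [ s ]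

    -- `dim-H X` and `dim-P X` both have this form, with `Z s` equal to `H s X` or `P s X`.
    inf-exponent-≤ : ∀ {s} → 0# ≤ s → Z s ≈⁺ 0⁺ → inf exponent ≤⁺ [ s ]
    inf-exponent-≤ {s} 0≤s Zs≈0 = inf-lower exponent (s , 0≤s , Zs≈0) [ 0≤s ]

    -- The exponent `a` at which `Z` vanishes may lie below `u`; comparisons with larger exponents
    -- are made later on the level of powers, by `pow-antiʳ-≤`.
    inf-exponent-≤⇒ : ∀ {s u} → s < u → inf exponent ≤⁺ [ s ] → ∃ λ a → 0# ≤ a × a ≤ u × Z a ≈⁺ 0⁺
    inf-exponent-≤⇒ s<u inf≤s =
      let ((a , 0≤a , Za≈0) , a≤u) = inf-approx exponent s<u inf≤s
      in a , 0≤a , ≤⁺⁻¹ a≤u , Za≈0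

-- Finite families as sequences, least elements and bounds.

family-All : ∀ {a p} {A : Set a} {P : A → Set p} {k} {F : Fin k → A} → (∀ j → P (F j)) → ∀ i → All P (family F i)
family-All {k = zero}  PF i       = nothing
family-All {k = suc k} PF zero    = just (PF Fin.zero)
family-All {k = suc k} PF (suc i) = family-All (PF ∘ Fin.suc) i

family-Any : ∀ {a p} {A : Set a} {P : A → Set p} {k} {F : Fin k → A} j → P (F j) → Any P (family F (Fin.toℕ j))
family-Any Fin.zero    p = just p
family-Any (Fin.suc j) p = family-Any j p

family-All² : ∀ {A : Set} {Q : A → A → Set} {k} {F : Fin k → A} → (∀ i j → i ≢ j → Q (F i) (F j)) →
              ∀ i j → i ≢ j → All (λ x → All (Q x) (family F j)) (family F i)
family-All² {k = zero}  QF i j _ = nothing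
family-All² {k = suc k} QF zero    zero    i≢j = contradiction refl i≢j
family-All² {k = suc k} QF zero    (suc j) _   = just (family-All (λ j → QF Fin.zero (Fin.suc j) λ ()) j)
family-All² {k = suc k} {F = F} QF (suc i) zero    _   = family-All (λ i → just (QF (Fin.suc i) Fin.zero λ ())) i
family-All² {k = suc k} QF (suc i) (suc j) i≢j =
  family-All² (λ i j i≢j → QF (Fin.suc i) (Fin.suc j) (i≢j ∘ Fin.suc-injective)) i j (i≢j ∘ ≡.cong suc)

least : Classical → (P : ℕ → Set) → ∃ P → ∃ λ n → P n × ∀ m → P m → n ℕ.≤ m
least lem P (n , Pn) = <-rec (λ n → P n → ∃ λ n → P n × ∀ m → P m → n ℕ.≤ m) search n Pn
  where
  search : ∀ n → (∀ {m} → m ℕ.< n → P m → ∃ λ n → P n × ∀ m → P m → n ℕ.≤ m) →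
           P n → ∃ λ n → P n × ∀ m → P m → n ℕ.≤ m
  search n rec Pn with lem {P = ∃ λ m → m ℕ.< n × P m}
  ... | yes (m , m<n , Pm) = rec m<n Pm
  ... | no ¬smaller        = n , Pn , λ m Pm → ℕ.≮⇒≥ λ m<n → ¬smaller (m , m<n , Pm)

abstract
  bound : (n : ℕ → ℕ) → ∀ K → ∃ λ L → ∀ i → i ℕ.< K → n i ℕ.≤ L
  bound n zero    = 0 , λ _ ()
  bound n (suc K) with bound (n ∘ suc) K
  ... | L , n≤L = n 0 ℕ.⊔ L , λ { zero    _         → ℕ.m≤m⊔n (n 0) L
                                ; (suc i) (ℕ.s≤s i<K) → ℕ.≤-trans (n≤L i i<K) (ℕ.m≤n⊔m (n 0) L) }

-- The metric of `[T]` and the covering numbers of `[S]`.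

module Proof (lem : Classical) (R : Reals) (S T : Pred (List ℕ) 0ℓ)
             (isTreeS : IsTree S) (isTreeT : IsTree T) (S⊆T : S ⊆ T)
             (finite : FinitelyBranching T) (two : TwoSuccessors T)
             (noLeaves : NoLeaves S) (uniform : UniformlyBranching S) where

  open Reals R
  open ExtendedReals lem R
  open RealProperties lem R
  open ExtendedProperties lem R
  open PathSpace lem R T
  open PartialOrderReasoning (TotalOrder.poset ≤-totalOrder)

  private
    module T where
      open TreeProperties lem T isTreeT public
      open FinitelyBranchingTree finite public
      open Growth finite two public

  open TreeProperties lem S isTreeS
  open Uniform (finitelyBranching-⊆ lem isTreeS S⊆T finite) noLeaves uniform

  X : Pred Path 0ℓ
  X = paths S

  -- The distance of two paths that agree on exactly their first `n` entries, since `τ` is antitone.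
  τ : ℕ → ℝ
  τ n = fromℕ ∣ OfLength T n ∣ ⁻¹

  ∣T∣≡ : ∀ n → ∣ OfLength T n ∣ ≡ length (T.descendants n [])
  ∣T∣≡ n with lem {P = ∃ (HasCard (OfLength T n))}
  ... | yes (_ , card) = HasCard-unique card (T.level-card n)
  ... | no ¬card       = contradiction (_ , T.level-card n) ¬card

  n<∣T∣ : ∀ n → n ℕ.< ∣ OfLength T n ∣
  n<∣T∣ n = ≡.subst (n ℕ.<_) (≡.sym (∣T∣≡ n)) (T.length-descendants> n T.[]∈)

  0<∣T∣ : ∀ n → 0# < fromℕ ∣ OfLength T n ∣
  0<∣T∣ n = 0<fromℕ (ℕ.≤-trans (ℕ.s≤s ℕ.z≤n) (n<∣T∣ n))

  0<τ : ∀ n → 0# < τ n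
  0<τ n = 0<⁻¹ (0<∣T∣ n)

  τ-anti : ∀ {m n} → m ℕ.≤ n → τ n ≤ τ m
  τ-anti {m} {n} m≤n = ⁻¹-anti-≤ (0<∣T∣ m)
    (fromℕ-mono (≡.subst₂ ℕ._≤_ (≡.sym (∣T∣≡ m)) (≡.sym (∣T∣≡ n)) (T.level-mono m≤n)))

  -- The closed ball of radius α around f consists of the g with f ↾ n ≡ g ↾ n.
  IsLevel : ℝ → ℕ → Set
  IsLevel α n = τ n ≤ α × (∀ m → τ m ≤ α → n ℕ.≤ m)

  abstract
    level : ∀ {α} → 0# < α → ∃ (IsLevel α)
    -- `M` is at least `α ⁻¹`, and level `M` of `T` has more than `M` strings, so `τ M ≤ α`.
    level {α} 0<α = least lem (λ n → τ n ≤ α) (M , *-cancelʳ-≤ (0<∣T∣ M) (begin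
      τ M * fromℕ ∣ OfLength T M ∣  ≈⟨ *-inverseˡ (0<∣T∣ M) ⟩
      1#                            ≈⟨ *-inverseʳ (0<⇒≉0 0<α) ⟨
      α * α ⁻¹                      ≤⟨ *-monoʳ-≤ (proj₁ 0<α) (≤-trans α⁻¹≤M (fromℕ-mono (ℕ.<⇒≤ (n<∣T∣ M)))) ⟩
      α * fromℕ ∣ OfLength T M ∣    ∎))
      where
      M : ℕ
      M = proj₁ (archimedean (α ⁻¹))
      α⁻¹≤M : α ⁻¹ ≤ fromℕ M
      α⁻¹≤M = proj₂ (archimedean (α ⁻¹))

  Agree : ℕ → Path → Path → Set
  Agree n p q = proj₁ p ↾ n ≡ proj₁ q ↾ n

  agree⇒dist≤ : ∀ {α n p q} → 0# < α → IsLevel α n → Agree n p q → dist p q ≤⁺ [ α ]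
  agree⇒dist≤ {n = n} 0<α (τn≤α , _) agree = sup-least _ [ proj₁ 0<α ] λ (k , pk≢qk) →
    [ [ (λ n≤k → ≤-trans (τ-anti n≤k) τn≤α) , (λ k<n → contradiction (↾-lookup k<n agree) pk≢qk) ]′ (ℕ.≤-<-connex n k) ]

  -- By minimality of the level, `τ k ≤ α` fails for `k` below `n`, so no difference can occur
  -- there.
  dist≤⇒agree : ∀ {α n p q} → IsLevel α n → dist p q ≤⁺ [ α ] → Agree n p q
  dist≤⇒agree {α} {n} {p} {q} (_ , minimal) dist≤α = ↾-ext n same
    where
    same : ∀ k → k ℕ.< n → proj₁ p k ≡ proj₁ q k
    same k k<n with lem {P = proj₁ p k ≡ proj₁ q k}
    ... | yes eq = eq
    ... | no neq = contradiction k<n (ℕ.≤⇒≯ (minimal k (≤⁺⁻¹ (sup-upper {I = ∃ λ n → proj₁ p n ≢ proj₁ q n} _ (k , neq) ⊚ dist≤α))))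

  diam≤⇒agree : ∀ {α n U p q} → IsLevel α n → diam U ≤⁺ [ α ] → p ∈ U → q ∈ U → Agree n p q
  diam≤⇒agree {p = p} {q} isLevel diam≤α p∈U q∈U = dist≤⇒agree {p = p} {q} isLevel (sup-upper _ (p , q , p∈U , q∈U) ⊚ diam≤α)

  agree⇒diam≤ : ∀ {α n U} → 0# < α → IsLevel α n → (∀ {p q} → p ∈ U → q ∈ U → Agree n p q) → diam U ≤⁺ [ α ]
  agree⇒diam≤ 0<α isLevel agree = sup-least _ [ proj₁ 0<α ] λ (p , q , p∈U , q∈U) →
    agree⇒dist≤ {p = p} {q} 0<α isLevel (agree p∈U q∈U)

  extendPath : ∀ {σ} → σ ∈ S → ∃ λ p → p ∈ X × Through σ (proj₁ p)
  extendPath σ∈ = let (f , f∈S , through) = extend σ∈ in (f , λ n → S⊆T (f∈S n)) , f∈S , through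

  cylinder : ∀ n → Fin (size n) → Pred Path 0ℓ
  cylinder n i p = proj₁ p ↾ n ≡ lookup (descendants n []) i

  diam-cylinder : ∀ {α n} → 0# < α → IsLevel α n → ∀ i → diam (cylinder n i) ≤⁺ [ α ]
  diam-cylinder {n = n} 0<α isLevel i = agree⇒diam≤ {U = cylinder n i} 0<α isLevel λ p∈ q∈ → ≡.trans p∈ (≡.sym q∈)

  cylinder-cover : ∀ n → X ⊆ ⋃ (Fin (size n)) (cylinder n)
  cylinder-cover n {f , _} f∈S = Any.index f↾n∈ , Any.lookup-index f↾n∈
    where f↾n∈ = ↾∈descendants 0 n (f∈S n)

  N-≤ : ∀ {α n} → 0# < α → IsLevel α n → N α X ≤⁺ [ fromℕ (size n) ]
  N-≤ {n = n} 0<α isLevel = inf-lower _ (size n , cylinder n , diam-cylinder 0<α isLevel , λ {p} → cylinder-cover n {p}) [ 0≤fromℕ (size n) ]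

  -- Choose a path through each string of level `n`. A set of diameter at most `α` contains at most
  -- one of these paths.
  N-≥ : ∀ {α n} → IsLevel α n → [ fromℕ (size n) ] ≤⁺ N α X
  N-≥ {α} {n} isLevel = inf-greatest _ λ (k , U , small , cover) →
    [ fromℕ-mono (Fin.injective⇒≤ {f = λ i → proj₁ (cover (proj₁ (proj₂ (string i))))} λ {i} {j} eq →
         lookup-injective (descendants-unique n []∈) i j (≡.trans (≡.sym (proj₂ (proj₂ (string i))))
           (≡.trans (diam≤⇒agree {U = U _} isLevel (small _) (proj₂ (cover (proj₁ (proj₂ (string i)))))
              (≡.subst (λ k → U k (proj₁ (string j))) (≡.sym eq) (proj₂ (cover (proj₁ (proj₂ (string j)))))))
             (proj₂ (proj₂ (string j)))))) ]
    where
    string : ∀ i → ∃ λ p → p ∈ X × proj₁ p ↾ n ≡ lookup (descendants n []) i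
    string i =
      let ρ∈ = ∈-lookup i
          (p , p∈ , through) = extendPath (proj₁ (descendants-sound n []∈ ρ∈))
      in p , p∈ , ≡.trans (≡.cong (proj₁ p ↾_) (≡.sym (descendants-length n []∈ ρ∈))) through

  -- Box dimensions as bounds on level sizes.

  ratio : ℝ → ℝ⁺
  ratio α = log⁺ (N α X) ÷ log (α ⁻¹)

  logRatio : ℝ → ℕ → ℝ
  logRatio α n = log (fromℕ (size n)) * log (α ⁻¹) ⁻¹

  1≤size⁺ : ∀ n → 1# ≤ fromℕ (size n)
  1≤size⁺ n = 1≤fromℕ (1≤size n)

  0<size : ∀ n → 0# < fromℕ (size n)
  0<size n = 0<fromℕ (1≤size n)

  ratio≈ : ∀ {α n} → 0# < α → IsLevel α n → ratio α ≈⁺ [ logRatio α n ]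
  ratio≈ {α} {n} 0<α isLevel = log⁺÷-≈ (N α X) (≤⁺-antisym (N-≤ 0<α isLevel) (N-≥ isLevel))
    where
    log⁺÷-≈ : ∀ x {y} → x ≈⁺ [ fromℕ (size n) ] → log⁺ x ÷ y ≈⁺ [ log (fromℕ (size n)) * y ⁻¹ ]
    log⁺÷-≈ [ _ ] [ x≈ ] = [ *-congʳ (≈-sym (log-cong (0<size n) (≈-sym x≈))) ]

  module _ {α : ℝ} {n : ℕ} (0<α : 0# < α) (α<1 : α < 1#) (isLevel : IsLevel α n) where

    private
      0<ℓ : 0# < log (α ⁻¹)
      0<ℓ = 0<log⁻¹ 0<α α<1

      logRatio*ℓ : logRatio α n * log (α ⁻¹) ≈ log (fromℕ (size n))
      logRatio*ℓ = begin-equality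
        log (fromℕ (size n)) * log (α ⁻¹) ⁻¹ * log (α ⁻¹)    ≈⟨ *-assoc _ _ _ ⟩
        log (fromℕ (size n)) * (log (α ⁻¹) ⁻¹ * log (α ⁻¹))  ≈⟨ *-congˡ (*-inverseˡ 0<ℓ) ⟩
        log (fromℕ (size n)) * 1#                            ≈⟨ *-identityʳ _ ⟩
        log (fromℕ (size n))                                 ∎

    -- Required by `inf-lower` in order to pass from the lower limit to the ratio at a single `α`.
    0≤ratio : 0⁺ ≤⁺ ratio α
    0≤ratio = [ *-nonneg (≤-trans (≤-reflexive (≈-sym log1≈0)) (log-mono-≤ 0<1 (1≤size⁺ n))) (proj₁ (0<⁻¹ 0<ℓ)) ]
      ⊚ ≈⁺⇒≥⁺ (ratio≈ 0<α isLevel)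

    ratio≤⇒ : ∀ {u} → ratio α ≤⁺ [ u ] → fromℕ (size n) * pow α u ≤ 1#
    ratio≤⇒ {u} ratio≤u = begin
      fromℕ (size n) * pow α u              ≈⟨ *-congʳ (exp-log (0<size n)) ⟨
      exp (log (fromℕ (size n))) * pow α u  ≤⟨ *-monoˡ-≤ (0≤pow α u) (exp-mono-≤ log≤) ⟩
      exp (u * log (α ⁻¹)) * pow α u        ≈⟨ *-comm _ _ ⟩
      pow α u * pow (α ⁻¹) u                ≈⟨ pow-⁻¹ u 0<α ⟩
      1#                                    ∎
      where
      log≤ : log (fromℕ (size n)) ≤ u * log (α ⁻¹)
      log≤ = ≤-trans (≤-reflexive (≈-sym logRatio*ℓ))
        (*-monoˡ-≤ (proj₁ 0<ℓ) (≤⁺⁻¹ (≈⁺⇒≥⁺ (ratio≈ 0<α isLevel) ⊚ ratio≤u)))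

    ≤ratio⇒ : ∀ {w} → [ w ] ≤⁺ ratio α → 1# ≤ fromℕ (size n) * pow α w
    ≤ratio⇒ {w} w≤ratio = begin
      1#                                    ≈⟨ pow-⁻¹ w 0<α ⟨
      pow α w * pow (α ⁻¹) w                ≈⟨ *-comm _ _ ⟩
      exp (w * log (α ⁻¹)) * pow α w        ≤⟨ *-monoˡ-≤ (0≤pow α w) (exp-mono-≤ ≤log) ⟩
      exp (log (fromℕ (size n))) * pow α w  ≈⟨ *-congʳ (exp-log (0<size n)) ⟩
      fromℕ (size n) * pow α w              ∎
      where
      ≤log : w * log (α ⁻¹) ≤ log (fromℕ (size n))
      ≤log = ≤-trans (*-monoˡ-≤ (proj₁ 0<ℓ) (≤⁺⁻¹ (w≤ratio ⊚ ≈⁺⇒≤⁺ (ratio≈ 0<α isLevel)))) (≤-reflexive logRatio*ℓ)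

  half-small : ∀ {x} → 0# < x → ∃ λ δ → 0# < δ × δ ≤ x × δ < 1#
  half-small {x} 0<x =
    let (δ , 0<δ , δ≤x , δ≤½) = min x ½ 0<x 0<½ in δ , 0<δ , δ≤x , ≤-<-trans δ≤½ ½<1
    where
    ½<1 : ½ < 1#
    ½<1 = begin-strict
      ½       ≈⟨ +-identityˡ ½ ⟨
      0# + ½  <⟨ +-monoˡ-< ½ 0<½ ⟩
      ½ + ½   ≈⟨ ½+½≈1 ⟩
      1#      ∎

  lower≤⇒ : ∀ {s u} → lower-dim-B X ≤⁺ [ s ] → s < u → ∀ {δ} → 0# < δ → δ < 1# →
            ∃₂ λ α n → 0# < α × α ≤ δ × IsLevel α n × fromℕ (size n) * pow α u ≤ 1#
  lower≤⇒ dim≤s s<u {δ} 0<δ δ<1 =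
    let (α , 0<α , α≤δ , ratio≤u) = liminf₀≤⇒ ratio s<u dim≤s 0<δ
        (n , isLevel) = level 0<α
    in α , n , 0<α , α≤δ , isLevel , ratio≤⇒ 0<α (≤-<-trans α≤δ δ<1) isLevel ratio≤u

  ≤lower⇒ : ∀ {w t} → [ t ] ≤⁺ lower-dim-B X → 0# ≤ w → w < t →
            ∃ λ δ → 0# < δ × (∀ {α n} → 0# < α → α ≤ δ → IsLevel α n → 1# ≤ fromℕ (size n) * pow α w)
  ≤lower⇒ t≤dim 0≤w w<t =
    let (δ , 0<δ , w≤ratio) = ≤liminf₀⇒ ratio 0≤w w<t t≤dim
        (δ′ , 0<δ′ , δ′≤δ , δ′<1) = half-small 0<δ
    in δ′ , 0<δ′ , λ {α} {n} 0<α α≤δ′ isLevel →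
      let α<1 = ≤-<-trans α≤δ′ δ′<1
      in ≤ratio⇒ 0<α α<1 isLevel (w≤ratio α 0<α (≤-trans α≤δ′ δ′≤δ) (0≤ratio 0<α α<1 isLevel))

  upper≤⇒ : ∀ {s u} → upper-dim-B X ≤⁺ [ s ] → s < u →
            ∃ λ δ → 0# < δ × (∀ {α n} → 0# < α → α ≤ δ → IsLevel α n → fromℕ (size n) * pow α u ≤ 1#)
  upper≤⇒ dim≤s s<u =
    let (δ , 0<δ , ratio≤u) = limsup₀≤⇒ ratio s<u dim≤s
        (δ′ , 0<δ′ , δ′≤δ , δ′<1) = half-small 0<δ
    in δ′ , 0<δ′ , λ {α} {n} 0<α α≤δ′ isLevel →
      ratio≤⇒ 0<α (≤-<-trans α≤δ′ δ′<1) isLevel (ratio≤u α 0<α (≤-trans α≤δ′ δ′≤δ))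

  ≤upper⇒ : ∀ {w t} → [ t ] ≤⁺ upper-dim-B X → 0# ≤ w → w < t → ∀ {δ} → 0# < δ → δ < 1# →
            ∃₂ λ α n → 0# < α × α ≤ δ × IsLevel α n × 1# ≤ fromℕ (size n) * pow α w
  ≤upper⇒ t≤dim 0≤w w<t {δ} 0<δ δ<1 =
    let (α , 0<α , α≤δ , w≤ratio) = ≤limsup₀⇒ ratio 0≤w w<t t≤dim 0<δ
        (n , isLevel) = level 0<α
    in α , n , 0<α , α≤δ , isLevel , ≤ratio⇒ 0<α (≤-<-trans α≤δ δ<1) isLevel w≤ratio

  -- The upper bound for Hausdorff dimension.

  Hδ-≤ : ∀ {δ w α n} → 0# ≤ w → 0# < α → α ≤ δ → IsLevel α n → Hδ δ w X ≤⁺ [ fromℕ (size n) * pow α w ]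
  Hδ-≤ {δ} {w} {α} {n} 0≤w 0<α α≤δ isLevel =
    inf-lower weight cover (0≤∑ (terms cover)) ⊚
    ∑-least (terms cover) [ *-nonneg (0≤fromℕ (size n)) (0≤pow α w) ]
      (sum⁺-family-≤ (λ U → diam U ^ w) (0≤pow α w) (cylinder n) λ i → ^≤pow 0≤w 0<α (diam-cylinder 0<α isLevel i))
    where
    terms : Cover δ X → ℕ → ℝ⁺
    terms C i = maybe (λ U → diam U ^ w) 0⁺ (Cover.sets C i)

    weight : Cover δ X → ℝ⁺
    weight C = ∑ (terms C)

    cover : Cover δ X
    cover = record
      { sets   = family (cylinder n)
      ; small  = family-All λ i → diam-cylinder 0<α isLevel i ⊚ [ α≤δ ]
      ; covers = λ p p∈ → let (i , p∈i) = cylinder-cover n {p} p∈ in Fin.toℕ i , family-Any i p∈i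
      }

  -- At a scale where `size n` times `pow α u` is at most 1, the cylinders of level `n` have total
  -- weight at most `pow α (w - u)`, and such scales are arbitrarily small.
  H≈0 : ∀ {s u w} → lower-dim-B X ≤⁺ [ s ] → 0# ≤ w → s < u → u < w → H w X ≈⁺ 0⁺
  H≈0 {s} {u} {w} dim≤s 0≤w s<u u<w =
    ≤⁺-antisym (sup-least {I = ∃ λ δ → 0# < δ} (λ (δ , _) → Hδ δ w X) ≤⁺-refl λ (δ , 0<δ) → ≤⁺0-by-ε (Hδ≤ε δ 0<δ)) (0≤sup _)
    where
    Hδ≤ε : ∀ δ → 0# < δ → ∀ ε → 0# < ε → Hδ δ w X ≤⁺ [ ε ]
    Hδ≤ε δ 0<δ ε 0<ε =
      -- `η` makes the spare power at most `ε`, `θ` also respects the mesh `δ`, and `κ` is below 1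
      -- so that `log (α ⁻¹)` is positive.
      let (η , 0<η , small)      = pow-small (<⇒0<- u<w) 0<ε
          (θ , 0<θ , θ≤δ , θ≤η)  = min δ η 0<δ 0<η
          (κ , 0<κ , κ≤θ , κ<1)  = half-small 0<θ
          (α , n , 0<α , α≤κ , isLevel , size≤) = lower≤⇒ dim≤s s<u 0<κ κ<1
          α≤θ = ≤-trans α≤κ κ≤θ
      in Hδ-≤ 0≤w 0<α (≤-trans α≤θ θ≤δ) isLevel ⊚ [ (begin
        fromℕ (size n) * pow α w                    ≈⟨ *-congˡ (pow-split α u w) ⟩
        fromℕ (size n) * (pow α u * pow α (w - u))  ≈⟨ *-assoc _ _ _ ⟨
        fromℕ (size n) * pow α u * pow α (w - u)    ≤⟨ *-mono-≤ (*-nonneg (0≤fromℕ (size n)) (0≤pow α u)) (proj₁ 0<ε) size≤ (small α 0<α (≤-trans α≤θ θ≤η)) ⟩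
        1# * ε                                      ≈⟨ *-identityˡ ε ⟩
        ε                                           ∎) ]

  dim-H≤lower : dim-H X ≤⁺ lower-dim-B X
  dim-H≤lower = ≤⁺-by-gap _ _ (0≤sup _) λ s t 0≤s s<t lower≤s t≤H →
    let (w , s<w , w<t) = <-dense s<t
        (u , s<u , u<w) = <-dense s<w
        0≤w = ≤-trans 0≤s (proj₁ s<w)
    in <⇒≱⁺ w<t (t≤H ⊚ inf-exponent-≤ (λ s → H s X) 0≤w (H≈0 lower≤s 0≤w s<u u<w))

  -- Mass distribution and the lower bound for Hausdorff dimension.

  fromℕ-length-concat : ∀ (A : ℕ → List (List ℕ)) K → fromℕ (length (concat (applyUpTo A K))) ≈ sum (λ i → fromℕ (length (A i))) K
  fromℕ-length-concat A zero    = ≈-refl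
  fromℕ-length-concat A (suc K) =
    ≈-trans (≈-trans (≈-reflexive (≡.cong fromℕ (length-++ (A 0)))) (fromℕ-+ (length (A 0)) _)) (+-congˡ (fromℕ-length-concat (A ∘ suc) K))

  size*cone : ∀ {f n L} → InfinitePath S f → n ℕ.≤ L → fromℕ (size n) * fromℕ (length (descendants (L ℕ.∸ n) (f ↾ n))) ≈ fromℕ (size L)
  size*cone {f} {n} {L} f∈S n≤L = ≈-trans (≈-sym (fromℕ-* (size n) _)) (≈-reflexive (≡.cong fromℕ
    (≡.trans (≡.subst (λ l → size l ℕ.* length (descendants m (f ↾ n)) ≡ size (l ℕ.+ m)) (length-applyUpTo f n) (size*length-descendants m (f∈S n)))
             (≡.cong size (ℕ.m+[n∸m]≡n n≤L)))))
    where m = L ℕ.∸ n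

  ↾∈cone : ∀ {f n L} → InfinitePath S f → n ℕ.≤ L → f ↾ L ∈ˡ descendants (L ℕ.∸ n) (f ↾ n)
  ↾∈cone {f} {n} {L} f∈S n≤L =
    ≡.subst (λ l → f ↾ l ∈ˡ descendants (L ℕ.∸ n) (f ↾ n)) (ℕ.m+[n∸m]≡n n≤L) (↾∈descendants n (L ℕ.∸ n) (f∈S _))

  -- The mass distribution principle for the measure giving each cylinder of level n the mass 1 / size n.
  mass-distribution : (V : ℕ → Pred Path 0ℓ) (n : ℕ → ℕ) (v : ℕ → ℝ) →
    (∀ i {p q} → p ∈ V i → q ∈ V i → Agree (n i) p q) →
    (∀ i → 0# ≤ v i) → (∀ i {p} → p ∈ V i → 1# ≤ fromℕ (size (n i)) * v i) →
    (∀ p → p ∈ X → ∃ λ i → p ∈ V i) → ∃ λ K → 1# ≤ sum v K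
  mass-distribution V n v agree 0≤v 1≤v cover = K , *-cancelʳ-≤ (0<size L) (begin
    1# * fromℕ (size L)                      ≈⟨ *-identityˡ _ ⟩
    fromℕ (size L)                           ≤⟨ fromℕ-mono (unique-⊆⇒length≤ (descendants-unique L []∈) ⊆cones) ⟩
    fromℕ (length (concat (applyUpTo A K)))  ≈⟨ fromℕ-length-concat A K ⟩
    sum (λ i → fromℕ (length (A i))) K       ≤⟨ sum-mono K A≤ ⟩
    sum (λ i → fromℕ (size L) * v i) K       ≈⟨ sum-*ˡ (fromℕ (size L)) v K ⟩
    fromℕ (size L) * sum v K                 ≈⟨ *-comm _ _ ⟩
    sum v K * fromℕ (size L)                 ∎)
    where
    Meets : ℕ → Set
    Meets i = ∃ λ p → p ∈ X × p ∈ V i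

    -- The cylinder of level `n i` around the part of `V i` in `[S]`. Unlike `V i` it is determined
    -- by finitely many entries, as compactness demands.
    hit : ℕ → Pred (ℕ → ℕ) 0ℓ
    hit i f = ∃ λ ((p , _) : Meets i) → proj₁ p ↾ n i ≡ f ↾ n i

    subcover : ∃ λ K → ∀ f → InfinitePath S f → ∃ λ i → i ℕ.< K × hit i f
    subcover = finite-subcover hit n (λ i f≡g (meets , eq) → meets , ≡.trans eq f≡g) λ f f∈S →
      let p = f , λ n → S⊆T (f∈S n)
          (i , p∈V) = cover p f∈S
      in i , (p , f∈S , p∈V) , refl

    K = proj₁ subcover
    L = proj₁ (bound n K)

    cone : ∀ i → Meets i → List (List ℕ)
    cone i (p , _) = descendants (L ℕ.∸ n i) (proj₁ p ↾ n i)

    A : ℕ → List (List ℕ)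
    A i with lem {P = Meets i}
    ... | yes meets = cone i meets
    ... | no _      = []

    cone⊆A : ∀ i meets {ρ} → ρ ∈ˡ cone i meets → ρ ∈ˡ A i
    cone⊆A i meets@(p , _ , p∈V) {ρ} ρ∈ with lem {P = Meets i}
    -- `lem` may have picked another path `q` of `V i`, but by `agree` both give the same cone.
    ... | yes (q , _ , q∈V) = ≡.subst (λ σ → ρ ∈ˡ descendants (L ℕ.∸ n i) σ) (agree i p∈V q∈V) ρ∈
    ... | no ¬meets         = contradiction meets ¬meets

    A≤ : ∀ i → i ℕ.< K → fromℕ (length (A i)) ≤ fromℕ (size L) * v i
    A≤ i i<K with lem {P = Meets i}
    ... | no _ = *-nonneg (0≤fromℕ (size L)) (0≤v i)
    ... | yes meets@(p , p∈X , p∈V) = begin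
      c                                  ≈⟨ *-identityˡ c ⟨
      1# * c                             ≤⟨ *-monoˡ-≤ (0≤fromℕ (length (cone i meets))) (1≤v i p∈V) ⟩
      fromℕ (size (n i)) * v i * c       ≈⟨ xy*z≈xz*y _ (v i) c ⟩
      fromℕ (size (n i)) * c * v i       ≈⟨ *-congʳ (size*cone p∈X (proj₂ (bound n K) i i<K)) ⟩
      fromℕ (size L) * v i               ∎
      where c = fromℕ (length (cone i meets))

    ⊆cones : ∀ {ρ} → ρ ∈ˡ descendants L [] → ρ ∈ˡ concat (applyUpTo A K)
    ⊆cones {ρ} ρ∈ =
      let (f , f∈S , through) = extend (proj₁ (descendants-sound L []∈ ρ∈))
          (i , i<K , meets , eq) = proj₂ subcover f f∈S
          f↾L≡ρ = ≡.trans (≡.cong (f ↾_) (≡.sym (descendants-length L []∈ ρ∈))) through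
          ρ∈cone = ≡.subst₂ (λ ρ σ → ρ ∈ˡ descendants (L ℕ.∸ n i) σ) f↾L≡ρ (≡.sym eq) (↾∈cone f∈S (proj₂ (bound n K) i i<K))
      in ∈-concat⁺′ (cone⊆A i meets ρ∈cone) (∈-applyUpTo⁺ A i<K)

  -- Sets of diameter 0 cost nothing, but lie in cylinders of arbitrarily small mass;
  -- the terms geometric ½ i, of total at most ½, pay for these cylinders.
  ≤Hδ : ∀ {a δ} → 0# < δ → 0# ≤ a → (∀ {α n} → 0# < α → α ≤ δ → IsLevel α n → 1# ≤ fromℕ (size n) * pow α a) →
        [ ½ ] ≤⁺ Hδ δ a X
  ≤Hδ {a} {δ} 0<δ 0≤a 1≤size = inf-greatest _ ½≤∑
    where
    term : Maybe (Pred Path 0ℓ) → ℝ⁺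
    term = maybe (λ U → diam U ^ a) 0⁺

    -- Equivalent to Any (p ∈_), which is in Set₁.
    member : Maybe (Pred Path 0ℓ) → Pred Path 0ℓ
    member = maybe id λ _ → ⊥

    member⁺ : ∀ {p M} → Any (p ∈_) M → p ∈ member M
    member⁺ (just p∈U) = p∈U

    -- Here `v` overestimates the term by at most `ε` and dominates the mass of a cylinder of level
    -- `n` containing the set. The last clause is conditional so that `nothing` can have weight 0.
    Approx : Maybe (Pred Path 0ℓ) → ℝ → ℝ → ℕ → Set
    Approx M ε v n = [ v ] ≤⁺ term M +⁺ [ ε ] × 0# ≤ v × (∀ {p q} → p ∈ member M → q ∈ member M → Agree n p q) ×
                     (∀ {p} → p ∈ member M → 1# ≤ fromℕ (size n) * v)

    approx : ∀ M {ε} → 0# < ε → All (λ U → diam U ≤⁺ [ δ ]) M → ∃₂ (Approx M ε)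
    approx nothing  0<ε _ = 0# , 0 , [ 0≤+ ≤-refl (proj₁ 0<ε) ] , ≤-refl , (λ ()) , λ ()
    approx (just U) 0<ε (just U≤δ) =
      let (α , 0<α , α≤δ , U≤α , pow≤) = ^-approx (0≤sup _) 0<δ U≤δ 0≤a 0<ε
          (n , isLevel) = level 0<α
      in pow α a , n , pow≤ , 0≤pow α a , diam≤⇒agree {U = U} isLevel U≤α , λ _ → 1≤size 0<α α≤δ isLevel

    ½≤∑ : (C : Cover δ X) → [ ½ ] ≤⁺ ∑ λ i → term (Cover.sets C i)
    -- After the errors have taken at most `½`, this much of the mass 1 remains. Being positive and
    -- independent of the cover, it is incompatible with Hausdorff measure 0.
    ½≤∑ C = cancel (sum⁺ terms K)
        ([ proj₂ mass ] ⊚ ≤-sum⁺+ K (proj₁ ∘ a-i) ⊚ +⁺-mono ≤⁺-refl [ sum-geometric K (proj₁ 0<½) ])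
      ⊚ sup-upper (sum⁺ terms) K
      where
      open Cover C
      terms : ℕ → ℝ⁺
      terms i = term (sets i)

      choice : ∀ i → ∃₂ (Approx (sets i) (geometric ½ i))
      choice i = approx (sets i) (0<geometric i 0<½) (small i)

      v : ℕ → ℝ
      v i = proj₁ (choice i)

      n : ℕ → ℕ
      n i = proj₁ (proj₂ (choice i))

      a-i : ∀ i → Approx (sets i) (geometric ½ i) (v i) (n i)
      a-i i = proj₂ (proj₂ (choice i))

      mass : ∃ λ K → 1# ≤ sum v K
      mass = mass-distribution (member ∘ sets) n v
        (λ i → proj₁ (proj₂ (proj₂ (a-i i)))) (λ i → proj₁ (proj₂ (a-i i))) (λ i → proj₂ (proj₂ (proj₂ (a-i i))))
        λ p p∈ → let (i , p∈i) = covers p p∈ in i , member⁺ p∈i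

      K = proj₁ mass

      cancel : ∀ A → [ 1# ] ≤⁺ A +⁺ [ ½ ] → [ ½ ] ≤⁺ A
      cancel ⊤⁺    _  = _ ≤⊤⁺
      cancel [ x ] le = [ +-cancelʳ-≤ ½ (≤-trans (≤-reflexive ½+½≈1) (≤⁺⁻¹ le)) ]

  lower≤dim-H : lower-dim-B X ≤⁺ dim-H X
  lower≤dim-H = ≤⁺-by-gap _ _ (0≤sup _) λ s t 0≤s s<t H≤s t≤lower →
    let (w , s<w , w<t) = <-dense s<t
        (u , s<u , u<w) = <-dense s<w
        (a , 0≤a , a≤u , Ha≈0) = inf-exponent-≤⇒ (λ s → H s X) s<u H≤s
        a≤w = ≤-trans a≤u (proj₁ u<w)
        (δ , 0<δ , 1≤size) = ≤lower⇒ t≤lower (≤-trans 0≤s (proj₁ s<w)) w<t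
        (κ , 0<κ , κ≤δ , κ<1) = half-small 0<δ
        -- The estimate of the level sizes holds for `w` but is required for `a`; since `a ≤ w` and
        -- `α ≤ 1#`, the power with exponent `a` is the larger one.
        ½≤Hκ = ≤Hδ 0<κ 0≤a λ {α} {n} 0<α α≤κ isLevel →
          ≤-trans (1≤size 0<α (≤-trans α≤κ κ≤δ) isLevel)
            (*-monoʳ-≤ (0≤fromℕ (size n)) (pow-antiʳ-≤ 0<α (≤-trans α≤κ (proj₁ κ<1)) a≤w))
    in <⇒≱⁺ 0<½ (½≤Hκ ⊚ sup-upper {I = ∃ λ δ → 0# < δ} (λ (δ , _) → Hδ δ a X) (κ , 0<κ) ⊚ ≈⁺⇒≤⁺ Ha≈0)

  -- The upper bound for packing dimension.

  -- A ball whose radius has level `n` owns a share of 1 in `size n` of a deep level `L`, and its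
  -- term is at most `C` times this share. Disjoint balls own disjoint shares, so finitely many
  -- terms add up to at most `C`.
  P₀δ-≤ : ∀ {δ w C} → 0# ≤ w → 0# ≤ C →
          (∀ {r n} → 0# < r → r ≤ δ → IsLevel r n → fromℕ (size n) * pow (r + r) w ≤ C) →
          P₀δ δ w X ≤⁺ [ C ]
  P₀δ-≤ {δ} {w} {C} 0≤w 0≤C size-pow≤ =
    sup-least weight [ 0≤C ] λ B → ∑-least (λ i → term⁺ (Packing.balls B i)) [ 0≤C ] (sum≤ B)
    where
    open Ball

    term⁺ : Maybe (Ball δ X) → ℝ⁺
    term⁺ = maybe (λ b → [ radius b + radius b ] ^ w) 0⁺

    weight : Packing δ X → ℝ⁺
    weight B = ∑ λ i → term⁺ (Packing.balls B i)

    term : Maybe (Ball δ X) → ℝ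
    term = maybe (λ b → pow (radius b + radius b) w) 0#

    term⁺≤term : ∀ M → term⁺ M ≤⁺ [ term M ]
    term⁺≤term nothing  = ≤⁺-refl
    term⁺≤term (just b) = ^≤pow 0≤w (0<+ (proj₁ (0<radius b)) (0<radius b)) ≤⁺-refl

    ballLevel : (b : Ball δ X) → ∃ (IsLevel (radius b))
    ballLevel b = level (0<radius b)

    levelOf : Maybe (Ball δ X) → ℕ
    levelOf = maybe (λ b → proj₁ (ballLevel b)) 0

    cone : ℕ → Maybe (Ball δ X) → List (List ℕ)
    cone L = maybe (λ b → descendants (L ℕ.∸ proj₁ (ballLevel b)) (proj₁ (centre b) ↾ proj₁ (ballLevel b))) []

    term≤ : ∀ L M → levelOf M ℕ.≤ L → fromℕ (size L) * term M ≤ C * fromℕ (length (cone L M))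
    term≤ L nothing  _   = ≤-reflexive (≈-trans (zeroʳ _) (≈-sym (zeroʳ C)))
    term≤ L (just b) n≤L = begin
      fromℕ (size L) * term (just b)      ≈⟨ *-congʳ (size*cone (centre∈X b) n≤L) ⟨
      fromℕ (size n) * c * term (just b)  ≈⟨ xy*z≈xz*y _ c _ ⟩
      fromℕ (size n) * term (just b) * c  ≤⟨ *-monoˡ-≤ (0≤fromℕ (length (cone L (just b)))) (size-pow≤ (0<radius b) (radius≤δ b) (proj₂ (ballLevel b))) ⟩
      C * c                               ∎
      where
      n = proj₁ (ballLevel b)
      c = fromℕ (length (cone L (just b)))

    cone⊆level : ∀ L M → levelOf M ℕ.≤ L → ∀ {ρ} → ρ ∈ˡ cone L M → ρ ∈ˡ descendants L []
    cone⊆level L (just b) n≤L {ρ} ρ∈ = ≡.subst (λ l → ρ ∈ˡ descendants l []) len (descendants-complete [] ρ (proj₁ (descendants-sound m σ∈ ρ∈)))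
      where
      n = proj₁ (ballLevel b)
      m = L ℕ.∸ n
      σ∈ = centre∈X b n
      len : length ρ ≡ L
      len = ≡.trans (descendants-length m σ∈ ρ∈) (≡.trans (≡.cong (ℕ._+ m) (length-applyUpTo (proj₁ (centre b)) n)) (ℕ.m+[n∸m]≡n n≤L))

    cone-unique : ∀ L M → Unique (cone L M)
    cone-unique L nothing  = []
    cone-unique L (just b) = descendants-unique (L ℕ.∸ proj₁ (ballLevel b)) (centre∈X b _)

    cone⊆ball : ∀ L b {ρ p} → ρ ∈ˡ cone L (just b) → Through ρ (proj₁ p) → p ∈ points b
    cone⊆ball L b {p = p} ρ∈ through = agree⇒dist≤ {p = centre b} {p} (0<radius b) (proj₂ (ballLevel b))
      (≡.sym (≡.trans (≡.cong (proj₁ p ↾_) (≡.sym (length-applyUpTo (proj₁ (centre b)) _))) (descendants-through (L ℕ.∸ proj₁ (ballLevel b)) (centre∈X b _) ρ∈ through)))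

    -- As `S` has no leaves, a string common to both cones lies on a path, and this path belongs to
    -- both balls.
    cone-disjoint : ∀ L M M′ → All (λ b → All (λ c → points b # points c) M′) M → Disjoint (cone L M) (cone L M′)
    cone-disjoint L (just b) (just c) (just (just b#c)) (ρ∈b , ρ∈c) =
      let (p , _ , through) = extendPath (proj₁ (descendants-sound (L ℕ.∸ proj₁ (ballLevel b)) (centre∈X b _) ρ∈b))
      in b#c {p} (cone⊆ball L b {p = p} ρ∈b through , cone⊆ball L c {p = p} ρ∈c through)

    sum≤ : (B : Packing δ X) → ∀ K → sum⁺ (λ i → term⁺ (Packing.balls B i)) K ≤⁺ [ C ]
    sum≤ B K = sum⁺-≤ K (λ i → term⁺≤term (balls i)) ⊚ [ *-cancelʳ-≤ (0<size L) (begin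
      sum (term ∘ balls) K * fromℕ (size L)                    ≈⟨ *-comm _ _ ⟩
      fromℕ (size L) * sum (term ∘ balls) K                    ≈⟨ sum-*ˡ (fromℕ (size L)) (term ∘ balls) K ⟨
      sum (λ i → fromℕ (size L) * term (balls i)) K            ≤⟨ sum-mono K (λ i i<K → term≤ L (balls i) (n≤L i i<K)) ⟩
      sum (λ i → C * fromℕ (length (A i))) K                   ≈⟨ sum-*ˡ C (λ i → fromℕ (length (A i))) K ⟩
      C * sum (λ i → fromℕ (length (A i))) K                   ≈⟨ *-congˡ (fromℕ-length-concat A K) ⟨
      C * fromℕ (length (concat (applyUpTo A K)))              ≤⟨ *-monoʳ-≤ 0≤C (fromℕ-mono (unique-⊆⇒length≤ A-unique A⊆level)) ⟩
      C * fromℕ (size L)                                       ∎) ]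
      where
      open Packing B
      L   = proj₁ (bound (levelOf ∘ balls) K)
      n≤L = proj₂ (bound (levelOf ∘ balls) K)

      A : ℕ → List (List ℕ)
      A i = cone L (balls i)

      A-unique : Unique (concat (applyUpTo A K))
      A-unique = Unique.concat⁺ (All.applyUpTo⁺₂ A K λ i → cone-unique L (balls i))
        (AllPairs.applyUpTo⁺₁ A K λ {i} {j} i<j _ → cone-disjoint L (balls i) (balls j) (disjoint i j (ℕ.<⇒≢ i<j)))

      A⊆level : ∀ {ρ} → ρ ∈ˡ concat (applyUpTo A K) → ρ ∈ˡ descendants L []
      A⊆level ρ∈ with ∈-concat⁻′ (applyUpTo A K) ρ∈
      ... | xs , ρ∈xs , xs∈ with ∈-applyUpTo⁻ A xs∈
      ...   | i , i<K , refl = cone⊆level L (balls i) (n≤L i i<K) ρ∈xs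

  P₀≈0 : ∀ {s u w} → upper-dim-B X ≤⁺ [ s ] → 0# ≤ w → s < u → u < w → P₀ w X ≤⁺ 0⁺
  P₀≈0 {s} {u} {w} dim≤s 0≤w s<u u<w = ≤⁺0-by-ε λ ε 0<ε →
    -- `D` is the factor by which the power of the diameter `2r` exceeds that of `r`; the target `ε`
    -- is divided by it in advance.
    let D = pow (1# + 1#) w
        0<D = 0<pow (1# + 1#) w
        0<ε/D = 0<* 0<ε (0<⁻¹ 0<D)
        (η , 0<η , small)     = pow-small (<⇒0<- u<w) 0<ε/D
        (θ , 0<θ , size≤)     = upper≤⇒ dim≤s s<u
        (δ , 0<δ , δ≤η , δ≤θ) = min η θ 0<η 0<θ
    in inf-lower {I = ∃ λ δ → 0# < δ} (λ (δ , _) → P₀δ δ w X) (δ , 0<δ) (0≤sup _) ⊚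
       P₀δ-≤ 0≤w (proj₁ 0<ε) λ {r} {n} 0<r r≤δ isLevel → begin
         fromℕ (size n) * pow (r + r) w                      ≈⟨ *-congˡ (double-pow 0<r) ⟩
         fromℕ (size n) * (pow r w * D)                      ≈⟨ *-assoc _ _ _ ⟨
         fromℕ (size n) * pow r w * D                        ≈⟨ *-congʳ (≈-trans (*-congˡ (pow-split r u w)) (≈-sym (*-assoc _ _ _))) ⟩
         fromℕ (size n) * pow r u * pow r (w - u) * D        ≤⟨ *-monoˡ-≤ (proj₁ 0<D) (*-mono-≤ (*-nonneg (0≤fromℕ (size n)) (0≤pow r u)) (proj₁ 0<ε/D)
                                                                 (size≤ 0<r (≤-trans r≤δ δ≤θ) isLevel) (small r 0<r (≤-trans r≤δ δ≤η))) ⟩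
         1# * (ε * D ⁻¹) * D                                 ≈⟨ *-congʳ (*-identityˡ _) ⟩
         ε * D ⁻¹ * D                                        ≈⟨ *-assoc _ _ _ ⟩
         ε * (D ⁻¹ * D)                                      ≈⟨ *-congˡ (*-inverseˡ 0<D) ⟩
         ε * 1#                                              ≈⟨ *-identityʳ ε ⟩
         ε                                                   ∎
    where
    double-pow : ∀ {r} → 0# < r → pow (r + r) w ≈ pow r w * pow (1# + 1#) w
    double-pow {r} 0<r = ≈-trans
      (exp-cong (*-congˡ (log-cong (0<+ (proj₁ 0<r) 0<r) (≈-sym (≈-trans (distribˡ r 1# 1#) (+-cong (*-identityʳ r) (*-identityʳ r)))))))
      (pow-* w 0<r 0<2)

  -- The constant sequence `X` covers `X`, and repeating it costs nothing because `P₀ w X` is 0.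
  P≈0 : ∀ {w} → P₀ w X ≤⁺ 0⁺ → P w X ≈⁺ 0⁺
  P≈0 {w} P₀≤0 = ≤⁺-antisym
    (inf-lower {I = ∃ λ (Xs : ℕ → Pred Path 0ℓ) → X ⊆ ⋃ ℕ Xs} total-P₀ ((λ _ → X) , λ p∈ → 0 , p∈) (0≤∑ λ _ → P₀ w X) ⊚
     ∑-least (λ _ → P₀ w X) ≤⁺-refl λ k → sum⁺-zero k λ _ → P₀≤0)
    (0≤inf {I = ∃ λ (Xs : ℕ → Pred Path 0ℓ) → X ⊆ ⋃ ℕ Xs} total-P₀)
    where
    total-P₀ : (∃ λ (Xs : ℕ → Pred Path 0ℓ) → X ⊆ ⋃ ℕ Xs) → ℝ⁺
    total-P₀ (Xs , _) = ∑ λ j → P₀ w (Xs j)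

  dim-P≤upper : dim-P X ≤⁺ upper-dim-B X
  dim-P≤upper = ≤⁺-by-gap _ _ (0≤sup _) λ s t 0≤s s<t upper≤s t≤P →
    let (w , s<w , w<t) = <-dense s<t
        (u , s<u , u<w) = <-dense s<w
        0≤w = ≤-trans 0≤s (proj₁ s<w)
    in <⇒≱⁺ w<t (t≤P ⊚ inf-exponent-≤ (λ s → P s X) 0≤w (P≈0 (P₀≈0 upper≤s 0≤w s<u u<w)))

  -- Category and the lower bound for packing dimension.

  -- Density provides a centre in `Y` over each string of level `n` above `σ`. Balls of radius `α`
  -- are cylinders of that level, so distinct strings give disjoint balls.
  ≤P₀δ : ∀ {Y : Pred Path 0ℓ} {δ α n a σ} → 0# ≤ a → 0# < α → α ≤ δ → IsLevel α n → σ ∈ S → length σ ℕ.≤ n →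
         Dense (λ f → ∃ λ f∈T → (f , f∈T) ∈ Y) σ →
         [ fromℕ (length (descendants (n ℕ.∸ length σ) σ)) * pow α a ] ≤⁺ P₀δ δ a Y
  ≤P₀δ {Y} {δ} {α} {n} {a} {σ} 0≤a 0<α α≤δ isLevel σ∈ σ≤n dense =
    ≤-sum⁺-family (λ b → [ Ball.radius b + Ball.radius b ] ^ a) ball (λ _ → pow≤term)
      ⊚ sup-upper (sum⁺ (terms packing)) k ⊚ sup-upper weight packing
    where
    m : ℕ
    m = n ℕ.∸ length σ

    k : ℕ
    k = length (descendants m σ)

    string : Fin k → List ℕ
    string = lookup (descendants m σ)

    length-string : ∀ i → length (string i) ≡ n
    length-string i = ≡.trans (descendants-length m σ∈ (∈-lookup i)) (ℕ.m+[n∸m]≡n σ≤n)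

    point : ∀ i → ∃ λ p → p ∈ Y × proj₁ p ↾ n ≡ string i
    point i =
      let (ρ∈ , μ , _ , eq) = descendants-sound m σ∈ (∈-lookup {xs = descendants m σ} i)
          (f , (f∈T , f∈Y) , through) = dense μ (≡.subst S eq ρ∈)
      in (f , f∈T) , f∈Y ,
         ≡.trans (≡.cong (f ↾_) (≡.sym (length-string i))) (≡.subst (λ ρ → Through ρ f) (≡.sym eq) through)

    ball : Fin k → Ball δ Y
    ball i = record
      { centre   = proj₁ (point i)
      ; radius   = α
      ; centre∈X = proj₁ (proj₂ (point i))
      ; 0<radius = 0<α
      ; radius≤δ = α≤δ
      }

    disjoint : ∀ i j → i ≢ j → Ball.points (ball i) # Ball.points (ball j)
    disjoint i j i≢j {p} (p∈i , p∈j) = i≢j (lookup-injective (descendants-unique m σ∈) i j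
      (≡.trans (≡.sym (proj₂ (proj₂ (point i))))
        (≡.trans (≡.trans (dist≤⇒agree {p = proj₁ (point i)} {p} isLevel p∈i) (≡.sym (dist≤⇒agree {p = proj₁ (point j)} {p} isLevel p∈j)))
          (proj₂ (proj₂ (point j))))))

    packing : Packing δ Y
    packing = record { balls = family ball ; disjoint = family-All² λ i j i≢j {p} → disjoint i j i≢j {p} }

    terms : Packing δ Y → ℕ → ℝ⁺
    terms B i = maybe (λ b → [ Ball.radius b + Ball.radius b ] ^ a) 0⁺ (Packing.balls B i)

    weight : Packing δ Y → ℝ⁺
    weight B = ∑ (terms B)

    -- The factor gained by using the diameter `α + α` instead of `α` is given away.
    pow≤term : [ pow α a ] ≤⁺ [ α + α ] ^ a
    pow≤term = [ pow-monoˡ-≤ 0≤a 0<α (x≤x+y α (proj₁ 0<α)) ] ⊚ pow≤^ a (0<+ (proj₁ 0<α) 0<α)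

  abstract
    -- The constants 1 and 2 are arbitrary: some covering has total premeasure at most 1, so its
    -- dense member does too, and for some `δ` the value of `P₀δ` is then at most 2. What matters is
    -- that this bound is finite.
    dense-piece : ∀ {a} → P a X ≈⁺ 0⁺ →
                  ∃₂ λ (Y : Pred Path 0ℓ) δ → 0# < δ × P₀δ δ a Y ≤⁺ [ 1# + 1# ] ×
                  ∃ λ σ → σ ∈ S × Dense (λ f → ∃ λ f∈T → (f , f∈T) ∈ Y) σ
    dense-piece {a} P≈0 =
      let ((Xs , cover) , ∑≤1) = inf-approx {I = ∃ λ (Xs : ℕ → Pred Path 0ℓ) → X ⊆ ⋃ ℕ Xs} total-P₀ 0<1 (≈⁺⇒≤⁺ P≈0)
          (j , σ , σ∈ , dense) = baire (λ j f → ∃ λ f∈T → (f , f∈T) ∈ Xs j) λ f f∈S →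
            let (j , f∈Xj) = cover {f , λ n → S⊆T (f∈S n)} f∈S in j , (λ n → S⊆T (f∈S n)) , f∈Xj
          P₀≤1 = term≤∑ {λ j → P₀ a (Xs j)} j (λ j → 0≤inf {I = ∃ λ δ → 0# < δ} (λ (δ , _) → P₀δ δ a (Xs j))) ⊚ ∑≤1
          ((δ , 0<δ) , P₀δ≤2) = inf-approx {I = ∃ λ δ → 0# < δ} (λ (δ , _) → P₀δ δ a (Xs j)) 1<2 P₀≤1
      in Xs j , δ , 0<δ , P₀δ≤2 , σ , σ∈ , dense
      where
      total-P₀ : (∃ λ (Xs : ℕ → Pred Path 0ℓ) → X ⊆ ⋃ ℕ Xs) → ℝ⁺
      total-P₀ (Xs , _) = ∑ λ j → P₀ a (Xs j)

      1<2 : 1# < 1# + 1#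
      1<2 = ≤-<-trans (≤-reflexive (≈-sym (+-identityˡ 1#))) (+-monoˡ-< 1# 0<1)

  -- The factor `½` keeps `α` strictly below `τ l`, although `min` supplies only non-strict bounds.
  level≥ : ∀ {α n l} → IsLevel α n → α ≤ τ l * ½ → l ℕ.≤ n
  level≥ {α} {n} {l} (τn≤α , _) α≤ = ℕ.≮⇒≥ λ n<l → <⇒≱ half<τ (begin
    τ l      ≤⟨ τ-anti (ℕ.<⇒≤ n<l) ⟩
    τ n      ≤⟨ τn≤α ⟩
    α        ≤⟨ α≤ ⟩
    τ l * ½  ∎)
    where
    half<τ : τ l * ½ < τ l
    half<τ = begin-strict
      τ l * ½            ≈⟨ +-identityˡ _ ⟨
      0# + τ l * ½       <⟨ +-monoˡ-< (τ l * ½) (0<* (0<τ l) 0<½) ⟩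
      τ l * ½ + τ l * ½  ≈⟨ x½+x½≈x (τ l) ⟩
      τ l                ∎

  -- The packing sees only the part of level `n` above `σ`. By uniform branching this is a fixed
  -- share of the whole level, so a constant independent of `α` makes up for the rest.
  size-bound : ∀ {Y : Pred Path 0ℓ} {δ α n a σ} → 0# ≤ a → 0# < α → α ≤ δ → IsLevel α n → σ ∈ S → length σ ℕ.≤ n →
               Dense (λ f → ∃ λ f∈T → (f , f∈T) ∈ Y) σ → P₀δ δ a Y ≤⁺ [ 1# + 1# ] →
               fromℕ (size n) * pow α a ≤ fromℕ (size (length σ)) * (1# + 1#)
  size-bound {Y} {α = α} {n} {a} {σ} 0≤a 0<α α≤δ isLevel σ∈ σ≤n dense P₀δ≤2 = begin
    fromℕ (size n) * pow α a                 ≈⟨ *-congʳ size≈ ⟩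
    fromℕ (size (length σ)) * c * pow α a    ≈⟨ *-assoc _ _ _ ⟩
    fromℕ (size (length σ)) * (c * pow α a)  ≤⟨ *-monoʳ-≤ (0≤fromℕ (size (length σ))) (≤⁺⁻¹ (≤P₀δ {Y} 0≤a 0<α α≤δ isLevel σ∈ σ≤n dense ⊚ P₀δ≤2)) ⟩
    fromℕ (size (length σ)) * (1# + 1#)      ∎
    where
    c : ℝ
    c = fromℕ (length (descendants (n ℕ.∸ length σ) σ))

    size≈ : fromℕ (size n) ≈ fromℕ (size (length σ)) * c
    size≈ = ≈-trans
      (≈-reflexive (≡.cong fromℕ (≡.sym (≡.trans (size*length-descendants (n ℕ.∸ length σ) σ∈) (≡.cong size (ℕ.m+[n∸m]≡n σ≤n))))))
      (fromℕ-* (size (length σ)) _)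

  -- At arbitrarily small scales `size n` times `pow α w` is at least 1. The packing in a dense
  -- piece bounds `size n` times `pow α a` by `C`, and the spare factor `pow α (w - u)` outweighs
  -- `C`.
  upper-gap : ∀ {a u w t} → 0# ≤ a → a ≤ u → u < w → w < t → P a X ≈⁺ 0⁺ → ¬ ([ t ] ≤⁺ upper-dim-B X)
  upper-gap {a} {u} {w} 0≤a a≤u u<w w<t Pa≈0 t≤upper with dense-piece Pa≈0
  ... | Y , δ , 0<δ , P₀δ≤2 , σ , σ∈ , dense = absurd scale
    where
    C : ℝ
    C = fromℕ (size (length σ)) * (1# + 1#)

    0<C : 0# < C
    0<C = 0<* (0<size (length σ)) 0<2

    0<1+C : 0# < 1# + C
    0<1+C = 0<+ 0≤1 0<C

    -- Chosen so that `C * ε` is strictly less than 1.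
    ε : ℝ
    ε = (1# + C) ⁻¹

    0≤ε : 0# ≤ ε
    0≤ε = proj₁ (0<⁻¹ 0<1+C)

    C*ε<1 : C * ε < 1#
    C*ε<1 = begin-strict
      C * ε         <⟨ *-monoˡ-< (0<⁻¹ 0<1+C) (≤-<-trans (≤-reflexive (≈-sym (+-identityˡ C))) (+-monoˡ-< C 0<1)) ⟩
      (1# + C) * ε  ≈⟨ *-inverseʳ (0<⇒≉0 0<1+C) ⟩
      1#            ∎

    Scale : ℝ → ℕ → Set
    Scale α n = 0# < α × α ≤ 1# × α ≤ δ × IsLevel α n × length σ ℕ.≤ n × pow α (w - u) ≤ ε × 1# ≤ fromℕ (size n) * pow α w

    scale : ∃₂ Scale
    scale =
      let (η , 0<η , small)    = pow-small (<⇒0<- u<w) (0<⁻¹ 0<1+C)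
          (θ , 0<θ , θ≤δ , θ≤η) = min δ η 0<δ 0<η
          (ι , 0<ι , ι≤θ , ι≤τ) = min θ (τ (length σ) * ½) 0<θ (0<* (0<τ (length σ)) 0<½)
          (κ , 0<κ , κ≤ι , κ<1) = half-small 0<ι
          (α , n , 0<α , α≤κ , isLevel , 1≤size) = ≤upper⇒ t≤upper (≤-trans 0≤a (≤-trans a≤u (proj₁ u<w))) w<t 0<κ κ<1
          α≤ι = ≤-trans α≤κ κ≤ι
          α≤θ = ≤-trans α≤ι ι≤θ
      in α , n , 0<α , ≤-trans α≤κ (proj₁ κ<1) , ≤-trans α≤θ θ≤δ , isLevel , level≥ isLevel (≤-trans α≤ι ι≤τ) ,
         small α 0<α (≤-trans α≤θ θ≤η) , 1≤size

    absurd : ∃₂ Scale → ⊥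
    absurd (α , n , 0<α , α≤1 , α≤δ , isLevel , σ≤n , pow≤ε , 1≤size) = <⇒≱ C*ε<1 (begin
      1#                                          ≤⟨ 1≤size ⟩
      fromℕ (size n) * pow α w                    ≈⟨ *-congˡ (pow-split α u w) ⟩
      fromℕ (size n) * (pow α u * pow α (w - u))  ≤⟨ *-monoʳ-≤ (0≤fromℕ (size n)) (*-mono-≤ (0≤pow α u) 0≤ε (pow-antiʳ-≤ 0<α α≤1 a≤u) pow≤ε) ⟩
      fromℕ (size n) * (pow α a * ε)              ≈⟨ *-assoc _ _ _ ⟨
      fromℕ (size n) * pow α a * ε                ≤⟨ *-monoˡ-≤ 0≤ε (size-bound {Y} 0≤a 0<α α≤δ isLevel σ∈ σ≤n dense P₀δ≤2) ⟩
      C * ε                                       ∎)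

  upper≤dim-P : upper-dim-B X ≤⁺ dim-P X
  upper≤dim-P = ≤⁺-by-gap _ _ (0≤sup _) λ s t 0≤s s<t P≤s t≤upper →
    let (w , s<w , w<t) = <-dense s<t
        (u , s<u , u<w) = <-dense s<w
        (a , 0≤a , a≤u , Pa≈0) = inf-exponent-≤⇒ (λ s → P s X) s<u P≤s
    in upper-gap 0≤a a≤u u<w w<t Pa≈0 t≤upper

theorem8p10 :
    (lem : Classical) (R : Reals) (S T : Pred (List ℕ) 0ℓ) →
    IsTree S → IsTree T → S ⊆ T →
    FinitelyBranching T → TwoSuccessors T →
    NoLeaves S → UniformlyBranching S →
    let open ExtendedReals lem R
        open PathSpace lem R T
    in (dim-H (paths S) ≈⁺ lower-dim-B (paths S)) ×
       (dim-P (paths S) ≈⁺ upper-dim-B (paths S))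
theorem8p10 lem R S T isTreeS isTreeT S⊆T finite two noLeaves uniform =
  ≤⁺-antisym dim-H≤lower lower≤dim-H , ≤⁺-antisym dim-P≤upper upper≤dim-P
  where
  open ExtendedProperties lem R using (≤⁺-antisym)
  open Proof lem R S T isTreeS isTreeT S⊆T finite two noLeaves uniform
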